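{- For every integer $n\ge 1$, the derivation $\partial_n$ on $\mathfrak H=\mathbb Q\langle x,y\rangle$ is given by the following identity of $\mathbb Q$-linear maps on $\mathfrak H$: $$\partial_n=\frac{n}{2^n-1}\sum_{d=1}^n\frac{(-1)^{d+1}}{d}\sum_{\substack{m_1+\dots+m_d=n\\ m_1,\dots,m_d\ge 1}}\lambda_{m_1}\cdots\lambda_{m_d},$$ where $\lambda_{m_1}\cdots\lambda_{m_d}$ denotes the rooted tree map corresponding to the forest consisting of the ladder trees $\lambda_{m_1},\dots,\lambda_{m_d}$.
   Context: **Forests.** A rooted tree is a finite connected graph without cycles with a distinguished vertex (the root); trees are considered without plane structure. A (rooted) forest is a finite product (disjoint union) of rooted trees. $\mathcal H$ is the commutative $\mathbb Q$-algebra of forests generated by all rooted trees, with unit $\mathbb I$ (the empty forest). The linear map $B_+:\mathcal H\to\mathcal H$ sends a forest to the tree obtained by connecting all roots of its trees to a new root ($B_+(\mathbb I)$ is the one-vertex tree). Every tree $t$ is $t=B_+(f_t)$ for a unique forest $f_t$. The Connes–Kreimer coproduct $\Delta:\mathcal H\to\mathcal H\otimes\mathcal H$ is defined recursively by $\Delta(\mathbb I)=\mathbb I\otimes\mathbb I$, $\Delta(t)=t\otimes\mathbb I+(\mathrm{id}\otimes B_+)\circ\Delta(f_t)$ for a tree $t$, and $\Delta(gh)=\Delta(g)\Delta(h)$ for forests $g,h$. **Ladder trees.** $\lambda_0=\mathbb I$ and $\lambda_m=B_+(\lambda_{m-1})$ for $m\ge1$, i.e. $\lambda_m$ is the tree with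 $m$ vertices and no branches. **Rooted tree maps.** Let $\mathfrak H=\mathbb Q\langle x,y\rangle$ be the noncommutative polynomial algebra (with concatenation product). To each forest $f$ one assigns a $\mathbb Q$-linear map on $\mathfrak H$, also denoted $f$ (extended $\mathbb Q$-linearly in $f$ to $\mathcal H$). The map of $\mathbb I$ is the identity. For a non-empty forest $f$ one has $f(1)=0$, and for a word $w$ and a letter $u\in\{x,y\}$, $$f(wu)=M(\Delta(f)(w\otimes u)),\qquad M(w_1\otimes w_2)=w_1w_2,$$ where $(f_1\otimes f_2)(w\otimes u)=f_1(w)\otimes f_2(u)$. On letters $u\in\{x,y\}$ the map $f$ is defined by: (i) if $f$ is the one-vertex tree, $f(x)=xy$ and $f(y)=-xy$; (ii) if $t=B_+(f)$ is a tree with $f\neq\mathbb I$, $t(u)=R_yR_{x+2y}R_y^{ -1}f(u)$, where $R_v(w)=wv$ for $v,w\in\mathfrak H$; (iii) if $f=gh$ with forests $g,h\ne\mathbb I$, $f(u)=g(h(u))$. This is known to be well defined (in particular $f(u)\in\mathfrak H y$ in (ii), and the result in (iii) does not depend on the factorization). **Derivation.** For $n\ge1$, $\partial_n$ is the derivation on $\mathfrak H$ (with respect to the concatenation product) determined by $\partial_n(x)=x(x+y)^{n-1}y$ and $\partial_n(y)=-x(x+y)^{n-1}y$. -}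

module Defs where

open import Data.Bool.Base using (if_then_else_)
open import Data.Integer.Base using (+_)
open import Data.List.Base using (List; []; _∷_; _++_; [_]; map; concat; concatMap; upTo; applyUpTo; reverse; initLast; _∷ʳ_; _∷ʳ′_)
import Data.List.Properties as List
open import Data.List.Relation.Unary.All using (All; []; _∷_; universal)
import Data.List.Relation.Unary.All.Properties as All
open import Data.Nat.Base as ℕ using (ℕ; zero; suc; pred; NonZero; _∸_; _≤_; z≤n; s≤s)
import Data.Nat.Properties as ℕ
open import Data.Nat.Tactic.RingSolver using (solve-∀)
open import Data.Product.Base using (_×_; _,_)
open import Data.Rational.Base as ℚ using (ℚ; 0ℚ; 1ℚ; _/_)
import Data.Rational.Properties as ℚ
open import Data.Unit.Base using (⊤; tt)
open import Data.Vec.Base using (Vec; []; _∷_; toList)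
open import Relation.Binary.Definitions using (DecidableEquality)
open import Relation.Binary.PropositionalEquality using (_≡_; refl; sym; trans; cong; cong₂; module ≡-Reasoning)
open import Relation.Nullary.Decidable using (yes; no; does)

infixl 6 _+ᴹ_
infixr 7 _*ₗ_
infixl 7 _⊗_ _*_
infixr 8 _^_
infix  4 _≈_

------------------------------------------------------------------------
-- Free ℚ-modules

-- Formal sums of basis elements; a basis element may occur repeatedly or
-- with coefficient 0, so elements are compared with _≈_ below, not _≡_.
Free : Set → Set
Free B = List (ℚ × B)

0ᴹ : {B : Set} → Free B
0ᴹ = []

_+ᴹ_ : {B : Set} → Free B → Free B → Free B
_+ᴹ_ = _++_

_*ₗ_ : {B : Set} → ℚ → Free B → Free B
c *ₗ p = map (λ (a , b) → (c ℚ.* a , b)) p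

η : {B : Set} → B → Free B
η b = [ (1ℚ , b) ]

lin : {B C : Set} → (B → Free C) → Free B → Free C
lin f []            = 0ᴹ
lin f ((c , b) ∷ p) = c *ₗ f b +ᴹ lin f p

_⊗_ : {B C : Set} → Free B → Free C → Free (B × C)
p ⊗ q = lin (λ b → lin (λ c → η (b , c)) q) p

∑ : {A B : Set} → List A → (A → Free B) → Free B
∑ as p = concatMap p as

-- The sum of a d over 1 ≤ d ≤ n.
∑₁ : {B : Set} → ℕ → ((d : ℕ) → .{{NonZero d}} → Free B) → Free B
∑₁ n a = ∑ (upTo n) (λ k → a (suc k))

------------------------------------------------------------------------
-- The algebra ℚ⟨x,y⟩

data Letter : Set where
  x y : Letter

Word : Set
Word = List Letter

𝔥 : Set
𝔥 = Free Word

_≟ᴸ_ : DecidableEquality Letter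
x ≟ᴸ x = yes refl
x ≟ᴸ y = no λ ()
y ≟ᴸ x = no λ ()
y ≟ᴸ y = yes refl

_≟ᵂ_ : DecidableEquality Word
_≟ᵂ_ = List.≡-dec _≟ᴸ_

coeff : 𝔥 → Word → ℚ
coeff []            w = 0ℚ
coeff ((c , v) ∷ p) w = (if does (v ≟ᵂ w) then c else 0ℚ) ℚ.+ coeff p w

_≈_ : 𝔥 → 𝔥 → Set
p ≈ q = ∀ w → coeff p w ≡ coeff q w

M : Free (Word × Word) → 𝔥
M = lin (λ (v , w) → η (v ++ w))

_*_ : 𝔥 → 𝔥 → 𝔥
p * q = M (p ⊗ q)

_^_ : 𝔥 → ℕ → 𝔥
p ^ zero  = η []
p ^ suc k = p * p ^ k

⟨_⟩ : Letter → 𝔥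
⟨ u ⟩ = η [ u ]

R : 𝔥 → 𝔥 → 𝔥
R v p = p * v

-- R-y⁻¹ is the inverse of R ⟨ y ⟩ on its image 𝔥y.  Words that do not end
-- in y are sent to 0, an arbitrary choice.
strip-y : Word → 𝔥
strip-y w with initLast w
... | []      = 0ᴹ
... | v ∷ʳ′ x = 0ᴹ
... | v ∷ʳ′ y = η v

R-y⁻¹ : 𝔥 → 𝔥
R-y⁻¹ = lin strip-y

------------------------------------------------------------------------
-- Forests

-- The trees of a forest are listed in some order.  The order carries no
-- meaning: a forest without plane structure is represented by any of its
-- orderings, and the product of forests is concatenation.
data Tree : Set where
  B₊ : List Tree → Tree

Forest : Set
Forest = List Tree

-- The number of vertices of a forest.
size : Forest → ℕ
size []         = 0
size (B₊ f ∷ g) = suc (size f ℕ.+ size g)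

ladder : ℕ → Forest
ladder zero    = []
ladder (suc m) = [ B₊ (ladder m) ]

ladders : {d : ℕ} → Vec ℕ d → Forest
ladders ms = concat (map ladder (toList ms))

-- The product of ℋ ⊗ ℋ.
_⊙_ : Free (Forest × Forest) → Free (Forest × Forest) → Free (Forest × Forest)
p ⊙ q = lin (λ (g₁ , g₂) → lin (λ (h₁ , h₂) → η (g₁ ++ h₁ , g₂ ++ h₂)) q) p

id⊗B₊ : Free (Forest × Forest) → Free (Forest × Forest)
id⊗B₊ = lin (λ (f₁ , f₂) → η (f₁ , [ B₊ f₂ ]))

Δ : Forest → Free (Forest × Forest)
Δ []         = η ([] , [])
Δ (B₊ f ∷ g) = (η ([ B₊ f ] , []) +ᴹ id⊗B₊ (Δ f)) ⊙ Δ g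

------------------------------------------------------------------------
-- Rooted tree maps

-- The action of a forest on a word, given the action L of forests on
-- letters, by the rule f(wu) = M(Δ(f)(w ⊗ u)).  Since that rule splits off
-- the last letter, the word is passed in reversed order.
extendʳ : (Forest → Letter → 𝔥) → Forest → Word → 𝔥
extendʳ L []      w       = η (reverse w)
extendʳ L (_ ∷ _) []      = 0ᴹ
extendʳ L (t ∷ f) (u ∷ w) =
  lin (λ (f₁ , f₂) → M (extendʳ L f₁ w ⊗ L f₂ u)) (Δ (t ∷ f))

extend : (Forest → Letter → 𝔥) → Forest → Word → 𝔥
extend L f w = extendʳ L f (reverse w)

-- The action on letters of the forests with at most n vertices; the bound
-- makes the recursion structural, as the rule for gh needs the action of g
-- on words, hence that on letters of the forests in Δ(g).  For size f ≤ n
-- the value at f does not depend on n (onLetter-irrelevant), and the second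
-- clause is never reached.  A product is factored into its first tree and the
-- rest; it is known, but not needed here, that the order of the trees does not
-- affect the resulting element of 𝔥.
onLetter : ℕ → Forest → Letter → 𝔥
onLetter _       []                   u = ⟨ u ⟩
onLetter zero    (_ ∷ _)              _ = 0ᴹ
onLetter (suc n) (t ∷ g@(_ ∷ _))      u =
  lin (extend (onLetter n) [ t ]) (onLetter n g u)
onLetter (suc n) (B₊ [] ∷ [])         x = ⟨ x ⟩ * ⟨ y ⟩
onLetter (suc n) (B₊ [] ∷ [])         y = (ℚ.- 1ℚ) *ₗ (⟨ x ⟩ * ⟨ y ⟩)
onLetter (suc n) (B₊ f@(_ ∷ _) ∷ [])  u =
  R ⟨ y ⟩ (R (⟨ x ⟩ +ᴹ (+ 2 / 1) *ₗ ⟨ y ⟩) (R-y⁻¹ (onLetter n f u)))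

letterMap : Forest → Letter → 𝔥
letterMap f = onLetter (size f) f

wordMap : Forest → Word → 𝔥
wordMap f = extend (onLetter (size f)) f

⟦_⟧ : Forest → 𝔥 → 𝔥
⟦ f ⟧ = lin (wordMap f)

-- The defining equations of these maps, free of the bound in onLetter, are
-- letterMap-product, letterMap-tree, wordMap-letter and wordMap-∷ʳ.
module _ {B C : Set} {P : B → Set} where

  lin-cong : {h k : B → Free C} → (∀ {b} → P b → h b ≡ k b) →
             ∀ {p} → All (λ (_ , b) → P b) p → lin h p ≡ lin k p
  lin-cong eq []         = refl
  lin-cong eq {(c , _) ∷ _} (pb ∷ all) =
    cong₂ _+ᴹ_ (cong (c *ₗ_) (eq pb)) (lin-cong eq all)

  All-lin : {Q : C → Set} {h : B → Free C} →
            (∀ {b} → P b → All (λ (_ , c) → Q c) (h b)) →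
            ∀ {p} → All (λ (_ , b) → P b) p → All (λ (_ , c) → Q c) (lin h p)
  All-lin i []         = []
  All-lin i (pb ∷ all) = All.++⁺ (All.map⁺ (i pb)) (All-lin i all)

lin-ext : {B C : Set} {h k : B → Free C} → (∀ b → h b ≡ k b) → ∀ p → lin h p ≡ lin k p
lin-ext eq p = lin-cong {P = λ _ → ⊤} (λ {b} _ → eq b) (universal (λ _ → tt) p)

*ₗ-identity : {B : Set} (p : Free B) → 1ℚ *ₗ p ≡ p
*ₗ-identity []            = refl
*ₗ-identity ((c , b) ∷ p) =
  cong₂ (λ c p → (c , b) ∷ p) (ℚ.*-identityˡ c) (*ₗ-identity p)

*ₗ-*ₗ : {B : Set} (a c : ℚ) (p : Free B) → a *ₗ (c *ₗ p) ≡ (a ℚ.* c) *ₗ p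
*ₗ-*ₗ a c []            = refl
*ₗ-*ₗ a c ((d , b) ∷ p) =
  cong₂ (λ c p → (c , b) ∷ p) (sym (ℚ.*-assoc a c d)) (*ₗ-*ₗ a c p)

module _ {B C : Set} (h : B → Free C) where

  lin-η : ∀ b → lin h (η b) ≡ h b
  lin-η b = trans (List.++-identityʳ _) (*ₗ-identity (h b))

  lin-*ₗ : ∀ c p → lin h (c *ₗ p) ≡ c *ₗ lin h p
  lin-*ₗ c []            = refl
  lin-*ₗ c ((d , b) ∷ p) = trans
    (cong₂ _++_ (sym (*ₗ-*ₗ c d (h b))) (lin-*ₗ c p))
    (sym (List.map-++ _ (d *ₗ h b) (lin h p)))

  lin-+ᴹ : ∀ p q → lin h (p +ᴹ q) ≡ lin h p +ᴹ lin h q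
  lin-+ᴹ []            q = refl
  lin-+ᴹ ((c , b) ∷ p) q = trans (cong (c *ₗ h b ++_) (lin-+ᴹ p q))
    (sym (List.++-assoc (c *ₗ h b) (lin h p) (lin h q)))

  lin-lin : {A : Set} (k : A → Free B) → ∀ p → lin h (lin k p) ≡ lin (λ a → lin h (k a)) p
  lin-lin k []            = refl
  lin-lin k ((c , a) ∷ p) = trans (lin-+ᴹ (c *ₗ k a) (lin k p))
    (cong₂ _++_ (lin-*ₗ c (k a)) (lin-lin k p))

lin-0ᴹ : {B C : Set} (p : Free B) → lin {C = C} (λ _ → 0ᴹ) p ≡ 0ᴹ
lin-0ᴹ []      = refl
lin-0ᴹ (_ ∷ p) = lin-0ᴹ p

Splits : ℕ → Forest × Forest → Set
Splits n (f₁ , f₂) = size f₁ ℕ.+ size f₂ ≡ n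

size-++ : ∀ f g → size (f ++ g) ≡ size f ℕ.+ size g
size-++ []         g = refl
size-++ (B₊ f ∷ h) g = cong suc (trans (cong (size f ℕ.+_) (size-++ h g))
                                     (sym (ℕ.+-assoc (size f) (size h) (size g))))

interchange : ∀ a b c d → (a ℕ.+ c) ℕ.+ (b ℕ.+ d) ≡ (a ℕ.+ b) ℕ.+ (c ℕ.+ d)
interchange = solve-∀

Δ-splits : ∀ f → All (λ (_ , f₁₂) → Splits (size f) f₁₂) (Δ f)
Δ-splits []         = refl ∷ []
Δ-splits (B₊ f ∷ g) = All-lin {P = Splits (suc (size f))} {Q = Splits (size (B₊ f ∷ g))}
  {h = λ (g₁ , g₂) → lin (λ (h₁ , h₂) → η (g₁ ++ h₁ , g₂ ++ h₂)) (Δ g)}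
  (λ {(g₁ , g₂)} e → All-lin {P = Splits (size g)} {Q = Splits (size (B₊ f ∷ g))}
    {h = λ (h₁ , h₂) → η (g₁ ++ h₁ , g₂ ++ h₂)}
    (λ {(h₁ , h₂)} e′ → product g₁ g₂ h₁ h₂ e e′ ∷ []) (Δ-splits g))
  (_∷_ {x = 1ℚ , [ B₊ f ] , []} whole (All-lin {P = Splits (size f)} {Q = Splits (suc (size f))}
    {h = λ (f₁ , f₂) → η (f₁ , [ B₊ f₂ ])}
    (λ {(f₁ , f₂)} e → grafted f₁ f₂ e ∷ []) (Δ-splits f)))
  where
  whole : Splits (suc (size f)) ([ B₊ f ] , [])
  whole = trans (ℕ.+-identityʳ _) (cong suc (ℕ.+-identityʳ _))

  grafted : ∀ f₁ f₂ → Splits (size f) (f₁ , f₂) → Splits (suc (size f)) (f₁ , [ B₊ f₂ ])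
  grafted f₁ f₂ e = trans (ℕ.+-suc (size f₁) _)
    (cong suc (trans (cong (size f₁ ℕ.+_) (ℕ.+-identityʳ _)) e))

  product : ∀ g₁ g₂ h₁ h₂ → Splits (suc (size f)) (g₁ , g₂) → Splits (size g) (h₁ , h₂) →
            Splits (size (B₊ f ∷ g)) (g₁ ++ h₁ , g₂ ++ h₂)
  product g₁ g₂ h₁ h₂ e e′ = trans (cong₂ ℕ._+_ (size-++ g₁ h₁) (size-++ g₂ h₂))
    (trans (interchange (size g₁) (size g₂) (size h₁) (size h₂)) (cong₂ ℕ._+_ e e′))

left≤ : ∀ {f₁ f₂ m n} → Splits m (f₁ , f₂) → m ≤ n → size f₁ ≤ n
left≤ {f₁} e le = ℕ.≤-trans (ℕ.m+n≤o⇒m≤o (size f₁) (ℕ.≤-reflexive e)) le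

right≤ : ∀ {f₁ f₂ m n} → Splits m (f₁ , f₂) → m ≤ n → size f₂ ≤ n
right≤ {f₁} e le = ℕ.≤-trans (ℕ.m+n≤o⇒n≤o (size f₁) (ℕ.≤-reflexive e)) le

extendʳ-cong : ∀ {L L′ k} → (∀ f u → size f ≤ k → L f u ≡ L′ f u) →
               ∀ f w → size f ≤ k → extendʳ L f w ≡ extendʳ L′ f w
extendʳ-cong eq []        w       le = refl
extendʳ-cong eq (_ ∷ _)   []      le = refl
extendʳ-cong eq f@(_ ∷ _) (u ∷ w) le = lin-cong {P = Splits (size f)}
  (λ {(f₁ , f₂)} e → cong M (cong₂ _⊗_
    (extendʳ-cong eq f₁ w (left≤ {f₁} {f₂} e le))
    (eq f₂ u (right≤ {f₁} {f₂} e le))))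
  (Δ-splits f)

head≤ : ∀ t t′ (g : Forest) {n} → size (t ∷ t′ ∷ g) ≤ suc n → size [ t ] ≤ n
head≤ (B₊ f) (B₊ h) g (s≤s le) = ℕ.≤-trans
  (ℕ.≤-reflexive (cong suc (ℕ.+-identityʳ (size f))))
  (ℕ.≤-trans (ℕ.m≤m+n (suc (size f)) (size h ℕ.+ size g))
    (ℕ.≤-trans (ℕ.≤-reflexive (sym (ℕ.+-suc (size f) _))) le))

tail≤ : ∀ t (g : Forest) {n} → size (t ∷ g) ≤ suc n → size g ≤ n
tail≤ (B₊ f) g (s≤s le) = ℕ.m+n≤o⇒n≤o (size f) le

onLetter-irrelevant : ∀ m n f u → size f ≤ m → size f ≤ n → onLetter m f u ≡ onLetter n f u
onLetter-irrelevant m       n       []                  u _  _ = refl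
onLetter-irrelevant zero    n       (B₊ _ ∷ _)          u () _
onLetter-irrelevant (suc m) zero    (B₊ _ ∷ _)          u _  ()
onLetter-irrelevant (suc m) (suc n) (t ∷ g@(t′ ∷ g′))   u a  b = trans
  (cong (lin (extend (onLetter m) [ t ]))
    (onLetter-irrelevant m n g u (tail≤ t g a) (tail≤ t g b)))
  (lin-ext (λ w → extendʳ-cong {k = size [ t ]}
      (λ f v le → onLetter-irrelevant m n f v (ℕ.≤-trans le (head≤ t t′ g′ a))
                                              (ℕ.≤-trans le (head≤ t t′ g′ b)))
      [ t ] (reverse w) ℕ.≤-refl)
    (onLetter n g u))
onLetter-irrelevant (suc m) (suc n) (B₊ [] ∷ [])        x _  _ = refl
onLetter-irrelevant (suc m) (suc n) (B₊ [] ∷ [])        y _  _ = refl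
onLetter-irrelevant (suc m) (suc n) (B₊ f@(_ ∷ _) ∷ []) u (s≤s a) (s≤s b) =
  cong (λ p → R ⟨ y ⟩ (R (⟨ x ⟩ +ᴹ (+ 2 / 1) *ₗ ⟨ y ⟩) (R-y⁻¹ p)))
    (onLetter-irrelevant m n f u (ℕ.m+n≤o⇒m≤o (size f) a) (ℕ.m+n≤o⇒m≤o (size f) b))

onLetter≡letterMap : ∀ n f u → size f ≤ n → onLetter n f u ≡ letterMap f u
onLetter≡letterMap n f u le = onLetter-irrelevant n (size f) f u le ℕ.≤-refl

extend≡wordMap : ∀ n f w → size f ≤ n → extend (onLetter n) f w ≡ wordMap f w
extend≡wordMap n f w le = extendʳ-cong {k = size f}
  (λ g v le′ → onLetter-irrelevant n (size f) g v (ℕ.≤-trans le′ le) le′)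
  f (reverse w) ℕ.≤-refl

letterMap-product : ∀ t t′ g u →
  letterMap (t ∷ t′ ∷ g) u ≡ ⟦ [ t ] ⟧ (letterMap (t′ ∷ g) u)
letterMap-product t@(B₊ f) t′ g u = trans
  (cong (lin (extend (onLetter n) [ t ]))
    (onLetter≡letterMap n (t′ ∷ g) u (tail≤ t (t′ ∷ g) ℕ.≤-refl)))
  (lin-ext (λ w → extend≡wordMap n [ t ] w (head≤ t t′ g ℕ.≤-refl))
    (letterMap (t′ ∷ g) u))
  where n = size f ℕ.+ size (t′ ∷ g)

letterMap-tree : ∀ t f u → letterMap [ B₊ (t ∷ f) ] u ≡
  R ⟨ y ⟩ (R (⟨ x ⟩ +ᴹ (+ 2 / 1) *ₗ ⟨ y ⟩) (R-y⁻¹ (letterMap (t ∷ f) u)))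
letterMap-tree t f u =
  cong (λ p → R ⟨ y ⟩ (R (⟨ x ⟩ +ᴹ (+ 2 / 1) *ₗ ⟨ y ⟩) (R-y⁻¹ p)))
    (onLetter≡letterMap _ (t ∷ f) u (ℕ.m≤m+n (size (t ∷ f)) 0))

wordMap-∷ʳ : ∀ t f w u → wordMap (t ∷ f) (w ∷ʳ u) ≡
  lin (λ (f₁ , f₂) → M (wordMap f₁ w ⊗ letterMap f₂ u)) (Δ (t ∷ f))
wordMap-∷ʳ t f w u = trans
  (cong (extendʳ (onLetter n) (t ∷ f)) (List.reverse-++ w [ u ]))
  (lin-cong {P = Splits n}
    (λ {(f₁ , f₂)} e → cong M (cong₂ _⊗_
      (extend≡wordMap n f₁ w (left≤ {f₁} {f₂} e ℕ.≤-refl))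
      (onLetter≡letterMap n f₂ u (right≤ {f₁} {f₂} e ℕ.≤-refl))))
    (Δ-splits (t ∷ f)))
  where n = size (t ∷ f)

module _ {C : Set} where

  atUnit : (Forest → Free C) → Forest × Forest → Free C
  atUnit K ([]    , f) = K f
  atUnit K (_ ∷ _ , f) = 0ᴹ

  Δ-counitˡ : ∀ K f → lin (atUnit K) (Δ f) ≡ K f
  Δ-counitˡ K []         = lin-η (atUnit K) ([] , [])
  Δ-counitˡ K (B₊ f ∷ g) = begin
    lin (atUnit K) (Δt ⊙ Δ g)
      ≡⟨ lin-lin (atUnit K) (λ (g₁ , g₂) → lin (λ (h₁ , h₂) → η (g₁ ++ h₁ , g₂ ++ h₂)) (Δ g)) Δt ⟩
    lin (λ (g₁ , g₂) → lin (atUnit K) (lin (λ (h₁ , h₂) → η (g₁ ++ h₁ , g₂ ++ h₂)) (Δ g))) Δt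
      ≡⟨ lin-ext split Δt ⟩
    lin (atUnit (λ g₂ → K (g₂ ++ g))) Δt
      ≡⟨⟩
    lin (atUnit (λ g₂ → K (g₂ ++ g))) (id⊗B₊ (Δ f))
      ≡⟨ lin-lin (atUnit (λ g₂ → K (g₂ ++ g))) _ (Δ f) ⟩
    lin (λ (f₁ , f₂) → lin (atUnit (λ g₂ → K (g₂ ++ g))) (η (f₁ , [ B₊ f₂ ]))) (Δ f)
      ≡⟨ lin-ext graft (Δ f) ⟩
    lin (atUnit (λ f₂ → K (B₊ f₂ ∷ g))) (Δ f)
      ≡⟨ Δ-counitˡ (λ f₂ → K (B₊ f₂ ∷ g)) f ⟩
    K (B₊ f ∷ g) ∎
    where
    open ≡-Reasoning
    Δt : Free (Forest × Forest)
    Δt = η ([ B₊ f ] , []) +ᴹ id⊗B₊ (Δ f)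

    split : ∀ ((g₁ , g₂) : Forest × Forest) →
      lin (atUnit K) (lin (λ (h₁ , h₂) → η (g₁ ++ h₁ , g₂ ++ h₂)) (Δ g)) ≡
      atUnit (λ g₂ → K (g₂ ++ g)) (g₁ , g₂)
    split ([] , g₂) = trans (lin-lin (atUnit K) _ (Δ g)) (trans
      (lin-ext (λ { ([]    , h₂) → lin-η (atUnit K) _
                  ; (_ ∷ _ , h₂) → refl }) (Δ g))
      (Δ-counitˡ (λ h₂ → K (g₂ ++ h₂)) g))
    split (_ ∷ _ , g₂) = trans (lin-lin (atUnit K) _ (Δ g))
      (lin-0ᴹ (Δ g))

    graft : ∀ ((f₁ , f₂) : Forest × Forest) →
      lin (atUnit (λ g₂ → K (g₂ ++ g))) (η (f₁ , [ B₊ f₂ ])) ≡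
      atUnit (λ f₂ → K (B₊ f₂ ∷ g)) (f₁ , f₂)
    graft ([]    , f₂) = lin-η (atUnit (λ g₂ → K (g₂ ++ g))) _
    graft (_ ∷ _ , f₂) = refl

M-unitˡ : ∀ p → M (η [] ⊗ p) ≡ p
M-unitˡ p = trans (cong M (lin-η (λ v → lin (λ w → η (v , w)) p) []))
  (trans (lin-lin concatenate (λ w → η ([] , w)) p)
    (trans (lin-ext (λ w → lin-η concatenate ([] , w)) p) (lin-id p)))
  where
  concatenate : Word × Word → 𝔥
  concatenate (v , w) = η (v ++ w)

  lin-id : ∀ p → lin η p ≡ p
  lin-id []            = refl
  lin-id ((c , w) ∷ p) = cong₂ (λ c p → (c , w) ∷ p) (ℚ.*-identityʳ c) (lin-id p)

wordMap-letter : ∀ f u → wordMap f [ u ] ≡ letterMap f u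
wordMap-letter []         u = refl
wordMap-letter f@(t ∷ f′) u = trans (wordMap-∷ʳ t f′ [] u) (trans
  (lin-ext (λ { ([]    , f₂) → M-unitˡ (letterMap f₂ u)
              ; (_ ∷ _ , f₂) → refl }) (Δ f))
  (Δ-counitˡ (λ f₂ → letterMap f₂ u) f))

------------------------------------------------------------------------
-- Derivations and compositions

∂-letter : ℕ → Letter → 𝔥
∂-letter n x = ⟨ x ⟩ * (⟨ x ⟩ +ᴹ ⟨ y ⟩) ^ pred n * ⟨ y ⟩
∂-letter n y = (ℚ.- 1ℚ) *ₗ (⟨ x ⟩ * (⟨ x ⟩ +ᴹ ⟨ y ⟩) ^ pred n * ⟨ y ⟩)

∂-word : ℕ → Word → 𝔥
∂-word n []      = 0ᴹ
∂-word n (u ∷ w) = ∂-letter n u * η w +ᴹ ⟨ u ⟩ * ∂-word n w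

∂ : ℕ → 𝔥 → 𝔥
∂ n = lin (∂-word n)

-- All (m₁ , … , m_d) with every mᵢ ≥ 1 and m₁ + ⋯ + m_d = n.
compositions : (d n : ℕ) → List (Vec ℕ d)
compositions zero    zero    = [ [] ]
compositions zero    (suc _) = []
compositions (suc d) n       =
  concatMap (λ m → map (m ∷_) (compositions d (n ∸ m))) (applyUpTo suc n)

2^n∸1-nonZero : ∀ n .{{_ : NonZero n}} → NonZero (2 ℕ.^ n ∸ 1)
2^n∸1-nonZero (suc n) = ℕ.>-nonZero (ℕ.m<n⇒0<n∸m (ℕ.≤-trans (s≤s (s≤s z≤n))
  (ℕ.*-monoʳ-≤ 2 (ℕ.m^n>0 2 n))))

{-# OPTIONS --safe #-}
module Submission where

-- The coproduct of ladder trees makes Φ = Σ λₘ tᵐ a ring homomorphism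
-- 𝔥 → 𝔥[[t]], with Φ(z) = z for z = x + y and Φ(x) = x + x (1 − t(x+2y))⁻¹ t y.
-- Put θ = Σ (2ⁿ − 1) ∂ₙ tⁿ and N = t d/dt.  All of θΦ, Φθ and NΦ commute with z,
-- kill 1, and satisfy the same twisted Leibniz rule F(wx) = F(w) Φ(x) + Φ(w) W,
-- so they coincide.  Hence, for Ψ = Φ − 1, N(Ψᵈ⁺¹) = (d+1) θ (Ψᵈ + Ψᵈ⁺¹), and the
-- coefficient of tⁿ in N(log Φ) telescopes to θₙ = (2ⁿ − 1) ∂ₙ.  Finally, the
-- coefficient of tⁿ in Ψᵈ is the sum over compositions, because the map of a
-- product of ladders is the composite of their maps.

-- The weights 2ⁿ - 1 are dictated by Φ. Put q = x + 2y, A = 1 - tq, a = 1 - tz and b = 1 - 2tz.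
-- Since a = A + ty and b = A - tx, the images of the letters factor as Φ(x) = x A⁻¹ a and Φ(y) = b
-- A⁻¹ y, while NΦ(x) = W = x t A⁻² y. Let θ be a derivation that kills z and sends x to xZy, where
-- Z is a series with coefficients polynomial in z, so that Φ(Z) = Z. Then Φθ and NΦ agree at x if x
-- A⁻¹ (a Z b) A⁻¹ y = x t A⁻² y, that is, if a Z b = t. The solution t (1 - tz)⁻¹ (1 - 2tz)⁻¹
-- expands to Σ (2ⁿ - 1) zⁿ⁻¹ tⁿ, which gives the weighted sum of the ∂ₙ. Letters are represented by
-- operators of right multiplication. They then lie in the same ring as Φ and θ, and each Leibniz
-- rule becomes a commutation relation there; the products above appear in the code in reversed
-- order.

open import Algebra.Bundles using (CommutativeMonoid; Ring)
open import Data.Nat.Base as ℕ using (ℕ; zero; suc; NonZero; _∸_; _<_; s≤s)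
import Data.Nat.Properties as ℕ
open import Data.Product.Base using (_,_)
import Relation.Binary.PropositionalEquality as ≡
open ≡ using (_≡_)
open import Tactic.MonoidSolver using (solve)

-- Power series over a noncommutative ring

module Convolution {a ℓ} (A : CommutativeMonoid a ℓ) where
  open CommutativeMonoid A
  open import Algebra.Properties.CommutativeSemigroup commutativeSemigroup using (interchange)
  open import Algebra.Properties.Monoid.Mult monoid using (_×_; ×-homo-+; ×-congˡ)
  open import Algebra.Properties.CommutativeMonoid.Mult A using (×-distrib-+)
  open import Relation.Binary.Reasoning.Setoid setoid

  -- The sum of K i j over i + j = n.
  conv : (ℕ → ℕ → Carrier) → ℕ → Carrier
  conv K zero    = K 0 0
  conv K (suc n) = K 0 (suc n) ∙ conv (λ i → K (suc i)) n

  -- The relation i + j = n is passed on because both the Leibniz rule of `N` and the vanishing of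
  -- low coefficients depend on the degree.
  conv-cong-+ : ∀ {K K′} n → (∀ i j → i ℕ.+ j ≡ n → K i j ≈ K′ i j) → conv K n ≈ conv K′ n
  conv-cong-+ zero    eq = eq 0 0 ≡.refl
  conv-cong-+ (suc n) eq = ∙-cong (eq 0 (suc n) ≡.refl)
    (conv-cong-+ n (λ i j e → eq (suc i) j (≡.cong suc e)))

  conv-cong : ∀ {K K′} n → (∀ i j → K i j ≈ K′ i j) → conv K n ≈ conv K′ n
  conv-cong n eq = conv-cong-+ n (λ i j _ → eq i j)

  conv-ε : ∀ n → conv (λ _ _ → ε) n ≈ ε
  conv-ε zero    = refl
  conv-ε (suc n) = trans (identityˡ _) (conv-ε n)

  conv-∙ : ∀ K K′ n → conv (λ i j → K i j ∙ K′ i j) n ≈ conv K n ∙ conv K′ n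
  conv-∙ K K′ zero    = refl
  conv-∙ K K′ (suc n) = trans (∙-congˡ (conv-∙ _ _ n)) (interchange _ _ _ _)

  conv-last : ∀ K n → conv K (suc n) ≈ conv (λ i j → K i (suc j)) n ∙ K (suc n) 0
  conv-last K zero    = refl
  conv-last K (suc n) = trans (∙-congˡ (conv-last (λ i → K (suc i)) n)) (sym (assoc _ _ _))

  conv-swap : ∀ K n → conv (λ i j → K j i) n ≈ conv K n
  conv-swap K zero    = refl
  conv-swap K (suc n) = trans (∙-congˡ (conv-swap _ n))
    (trans (comm _ _) (sym (conv-last K n)))

  -- Both sides run over i + j + l = n; the induction splits off the terms with i = 0.
  conv-assoc : ∀ (T : ℕ → ℕ → ℕ → Carrier) n →
    conv (λ k l → conv (λ i j → T i j l) k) n ≈ conv (λ i m → conv (λ j l → T i j l) m) n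
  conv-assoc T zero    = refl
  conv-assoc T (suc n) = trans
    (∙-congˡ (trans (conv-∙ (λ k l → T 0 (suc k) l) _ n)
                    (∙-congˡ (conv-assoc (λ i → T (suc i)) n))))
    (sym (assoc _ _ _))

  conv-head : ∀ {K} n → (∀ i j → K (suc i) j ≈ ε) → conv K n ≈ K 0 n
  conv-head zero    eq = refl
  conv-head (suc n) eq = trans (∙-congˡ (trans (conv-cong n eq) (conv-ε n))) (identityʳ _)

  -- The Leibniz rule of t d/dt in its additive form: on the range of summation the factor n is i +
  -- j.
  conv-× : ∀ K n → n × conv K n ≈ conv (λ i j → i × K i j ∙ j × K i j) n
  conv-× K n = trans (hom n n K) (conv-cong-+ n λ i j e →
    trans (×-congˡ (≡.sym e)) (×-homo-+ (K i j) i j))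
    where
    hom : ∀ m n K → m × conv K n ≈ conv (λ i j → m × K i j) n
    hom m zero    K = refl
    hom m (suc n) K = trans (×-distrib-+ _ _ m) (∙-congˡ (hom m n _))

module PowerSeries {a ℓ} (R : Ring a ℓ) where
  open Ring R
  open Convolution +-commutativeMonoid
  open import Algebra.Properties.Semiring.Mult semiring
  open import Algebra.Properties.CommutativeMonoid.Mult +-commutativeMonoid using (×-distrib-+)

  private
    Series : Set a
    Series = ℕ → Carrier

    convˡ : ∀ n c K → c * conv K n ≈ conv (λ i j → c * K i j) n
    convˡ zero    c K = refl
    convˡ (suc n) c K = trans (distribˡ _ _ _) (+-congˡ (convˡ n c _))

    convʳ : ∀ n c K → conv K n * c ≈ conv (λ i j → K i j * c) n
    convʳ zero    c K = refl
    convʳ (suc n) c K = trans (distribʳ _ _ _) (+-congˡ (convʳ n c _))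

  infixl 7 _⋆_

  const : Carrier → Series
  const c zero    = c
  const c (suc _) = 0#

  shift : Series → Series
  shift f zero    = 0#
  shift f (suc n) = f n

  t : Series
  t = shift (const 1#)

  N : Series → Series
  N f n = n × f n

  opaque
    _⋆_ : Series → Series → Series
    (f ⋆ g) n = conv (λ i j → f i * g j) n

    ⋆-coefficient : ∀ f g n → (f ⋆ g) n ≡ conv (λ i j → f i * g j) n
    ⋆-coefficient f g n = ≡.refl

    const⋆ : ∀ c f n → (const c ⋆ f) n ≈ c * f n
    const⋆ c f n = conv-head n (λ _ _ → zeroˡ _)

    ⋆const : ∀ c f n → (f ⋆ const c) n ≈ f n * c
    ⋆const c f n = trans (sym (conv-swap _ n)) (conv-head n (λ _ _ → zeroʳ _))

    t⋆ : ∀ f n → (t ⋆ f) n ≈ shift f n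
    t⋆ f zero    = zeroˡ _
    t⋆ f (suc n) = trans (+-cong (zeroˡ _) (trans (const⋆ 1# f n) (*-identityˡ _))) (+-identityˡ _)

    ⋆t : ∀ f n → (f ⋆ t) n ≈ shift f n
    ⋆t f zero    = zeroʳ _
    ⋆t f (suc n) = trans (conv-last (λ i j → f i * t j) n)
      (trans (+-cong (trans (conv-cong n eq) (trans (⋆const 1# f n) (*-identityʳ _))) (zeroʳ _))
        (+-identityʳ _))
      where
      eq : ∀ i j → f i * t (suc j) ≈ f i * const 1# j
      eq i zero    = refl
      eq i (suc j) = refl

  infix 4 _≋_
  -- A record instead of the bare pointwise equality, so that both series can be inferred from the
  -- type of an equation.
  record _≋_ (f g : Series) : Set ℓ where
    constructor coefficientwise
    field at : ∀ n → f n ≈ g n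
  open _≋_ public

  infixl 6 _⊞_
  _⊞_ : Series → Series → Series
  (f ⊞ g) n = f n + g n

  ⊟_ : Series → Series
  (⊟ f) n = - f n

  0ˢ : Series
  0ˢ n = 0#

  opaque
    unfolding _⋆_

    ⋆-cong : ∀ {f f′ g g′} → f ≋ f′ → g ≋ g′ → f ⋆ g ≋ f′ ⋆ g′
    ⋆-cong e e′ = coefficientwise λ n → conv-cong n (λ i j → *-cong (at e i) (at e′ j))

    ⋆-assoc : ∀ f g h → (f ⋆ g) ⋆ h ≋ f ⋆ (g ⋆ h)
    ⋆-assoc f g h = coefficientwise λ n → trans
      (conv-cong n (λ k l → trans (convʳ k _ _) (conv-cong k (λ i j → *-assoc _ _ _))))
      (trans (conv-assoc (λ i j l → f i * (g j * h l)) n)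
             (conv-cong n (λ i m → sym (convˡ m _ _))))

    ⋆-distribˡ : ∀ f g h → f ⋆ (g ⊞ h) ≋ f ⋆ g ⊞ f ⋆ h
    ⋆-distribˡ f g h = coefficientwise λ n →
      trans (conv-cong n (λ i j → distribˡ _ _ _)) (conv-∙ _ _ n)

    ⋆-distribʳ : ∀ f g h → (g ⊞ h) ⋆ f ≋ g ⋆ f ⊞ h ⋆ f
    ⋆-distribʳ f g h = coefficientwise λ n →
      trans (conv-cong n (λ i j → distribʳ _ _ _)) (conv-∙ _ _ n)

    N-⋆ : ∀ f g → N (f ⋆ g) ≋ N f ⋆ g ⊞ f ⋆ N g
    N-⋆ f g = coefficientwise λ n → trans (conv-× _ n) (trans (conv-cong n λ i j →
      +-cong (sym (×-assoc-* i _ _)) (sym (×-comm-* j _ _))) (conv-∙ _ _ n))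

    ⋆-comm-coefficients : ∀ {f g} → (∀ i j → f i * g j ≈ g j * f i) → f ⋆ g ≋ g ⋆ f
    ⋆-comm-coefficients c = coefficientwise λ n → trans (conv-cong n c) (conv-swap _ n)

  ring : Ring a ℓ
  ring = record
    { Carrier = Series
    ; _≈_     = _≋_
    ; _+_     = _⊞_
    ; _*_     = _⋆_
    ; -_      = ⊟_
    ; 0#      = 0ˢ
    ; 1#      = const 1#
    ; isRing  = record
      { +-isAbelianGroup = record
        { isGroup = record
          { isMonoid = record
            { isSemigroup = record
              { isMagma = record
                { isEquivalence = record
                  { refl  = coefficientwise λ _ → refl
                  ; sym   = λ e → coefficientwise λ n → sym (at e n)
                  ; trans = λ e e′ → coefficientwise λ n → trans (at e n) (at e′ n)
                  }
                ; ∙-cong = λ e e′ → coefficientwise λ n → +-cong (at e n) (at e′ n)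
                }
              ; assoc = λ f g h → coefficientwise λ n → +-assoc _ _ _
              }
            ; identity = (λ f → coefficientwise λ n → +-identityˡ _)
                       , (λ f → coefficientwise λ n → +-identityʳ _)
            }
          ; inverse = (λ f → coefficientwise λ n → -‿inverseˡ _)
                    , (λ f → coefficientwise λ n → -‿inverseʳ _)
          ; ⁻¹-cong = λ e → coefficientwise λ n → -‿cong (at e n)
          }
        ; comm = λ f g → coefficientwise λ n → +-comm _ _
        }
      ; *-cong     = ⋆-cong
      ; *-assoc    = ⋆-assoc
      ; *-identity = (λ f → coefficientwise λ n → trans (const⋆ 1# f n) (*-identityˡ _))
                   , (λ f → coefficientwise λ n → trans (⋆const 1# f n) (*-identityʳ _))
      ; distrib    = ⋆-distribˡ , ⋆-distribʳ
      }
    }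

  private module S = Ring ring

  N-cong : ∀ {f g} → f ≋ g → N f ≋ N g
  N-cong e = coefficientwise λ n → ×-congʳ n (at e n)

  N-+ : ∀ f g → N (f S.+ g) ≋ N f S.+ N g
  N-+ f g = coefficientwise λ n → ×-distrib-+ _ _ n

  N-const : ∀ c → N (const c) ≋ S.0#
  N-const c = coefficientwise λ { zero → refl ; (suc n) → ×0 (suc n) }
    where
    ×0 : ∀ n → n × 0# ≈ 0#
    ×0 zero    = refl
    ×0 (suc n) = trans (+-identityˡ _) (×0 n)

  N-t : N t ≋ t
  N-t = coefficientwise λ
    { zero          → refl
    ; (suc zero)    → +-identityʳ _
    ; (suc (suc n)) → trans (+-identityˡ _) (at (N-const 1#) (suc n))
    }

  const-cong : ∀ {c d} → c ≈ d → const c ≋ const d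
  const-cong e = coefficientwise λ { zero → e ; (suc n) → refl }

  const-+ : ∀ c d → const (c + d) ≋ const c S.+ const d
  const-+ c d = coefficientwise λ { zero → refl ; (suc n) → sym (+-identityˡ 0#) }

  const-* : ∀ c d → const (c * d) ≋ const c S.* const d
  const-* c d = coefficientwise λ n → trans (eq n) (sym (const⋆ c (const d) n))
    where
    eq : ∀ n → const (c * d) n ≈ c * const d n
    eq zero    = refl
    eq (suc n) = sym (zeroʳ c)

  t-central : ∀ f → t S.* f ≋ f S.* t
  t-central f = coefficientwise λ n → trans (t⋆ f n) (sym (⋆t f n))

  -- Turns a first-order recurrence of coefficients into a fixed-point equation, the form in which
  -- `1-*ˡ` yields the factor 1 - tc. The mirror image is needed because the coefficients do not
  -- commute.
  recurrenceˡ : ∀ {c f g} → f 0 ≈ g 0 → (∀ n → f (suc n) ≈ g (suc n) + c * f n) →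
                f ≋ g S.+ t S.* const c S.* f
  recurrenceˡ {c} {f} {g} e₀ e = S.trans
    (coefficientwise λ
      { zero    → trans e₀ (sym (trans (+-congˡ (t⋆ (const c ⋆ f) 0)) (+-identityʳ _)))
      ; (suc n) → trans (e n) (+-congˡ (sym (trans (t⋆ (const c ⋆ f) (suc n)) (const⋆ c f n))))
      })
    (S.+-congˡ (S.sym (S.*-assoc t (const c) f)))

  recurrenceʳ : ∀ {c f g} → f 0 ≈ g 0 → (∀ n → f (suc n) ≈ g (suc n) + f n * c) →
                f ≋ g S.+ f S.* (t S.* const c)
  recurrenceʳ {c} {f} {g} e₀ e = S.trans
    (coefficientwise λ
      { zero    → trans e₀ (sym (trans (+-congˡ (t⋆ (f ⋆ const c) 0)) (+-identityʳ _)))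
      ; (suc n) → trans (e n) (+-congˡ (sym (trans (t⋆ (f ⋆ const c) (suc n)) (⋆const c f n))))
      })
    (S.+-congˡ (S.trans (S.sym (S.*-assoc t f (const c)))
      (S.trans (S.*-congʳ (t-central f)) (S.*-assoc f t (const c)))))

-- The twisted derivations of 𝔥, in an abstract ring

module TwistedDerivations {c ℓ} (S : Ring c ℓ) where
  open Ring S
  open import Algebra.Properties.Ring S
  open import Relation.Binary.Reasoning.Setoid setoid

  -- Inverses enter only as solutions of fixed-point equations. With v = 1 this says that s is a
  -- right inverse of 1 - u; other v give products such as (1 - tz)(1 - t(z+y))⁻¹ directly.
  1-*ˡ : ∀ {u s v} → s ≈ v + u * s → (1# - u) * s ≈ v
  1-*ˡ {u} {s} {v} e = begin
    (1# - u) * s           ≈⟨ distribʳ s 1# (- u) ⟩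
    1# * s + - u * s       ≈⟨ +-cong (trans (*-identityˡ s) e) (sym (-‿distribˡ-* u s)) ⟩
    v + u * s - u * s      ≈⟨ +-assoc _ _ _ ⟩
    v + (u * s - u * s)    ≈⟨ +-congˡ (-‿inverseʳ _) ⟩
    v + 0#                 ≈⟨ +-identityʳ v ⟩
    v ∎

  1-*ʳ : ∀ {u s v} → s ≈ v + s * u → s * (1# - u) ≈ v
  1-*ʳ {u} {s} {v} e = begin
    s * (1# - u)           ≈⟨ distribˡ s 1# (- u) ⟩
    s * 1# + s * - u       ≈⟨ +-cong (trans (*-identityʳ s) e) (sym (-‿distribʳ-* s u)) ⟩
    v + s * u - s * u      ≈⟨ +-assoc _ _ _ ⟩
    v + (s * u - s * u)    ≈⟨ +-congˡ (-‿inverseʳ _) ⟩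
    v + 0#                 ≈⟨ +-identityʳ v ⟩
    v ∎

  module Generators (x y t B Z : Carrier) (t-central : ∀ s → t * s ≈ s * t) where

    -- B stands for (1 − t(z+y))⁻¹ and Z for t (1 − 2tz)⁻¹ (1 − tz)⁻¹; then X, Y
    -- and W are the images of x, y and y Z x under Φ.
    z P X Y W a b : Carrier
    z = x + y
    P = t * B
    X = x + y * P * x
    Y = y - y * P * x
    W = y * B * P * x
    a = 1# - t * z
    b = 1# - t * (z + z)

    X+Y≈z : X + Y ≈ z
    X+Y≈z = begin
      (x + y * P * x) + (y - y * P * x)      ≈⟨ +-assoc _ _ _ ⟩
      x + (y * P * x + (y - y * P * x))      ≈⟨ +-congˡ (x+[y-x]≈y _ _) ⟩
      x + y ∎
      where
      x+[y-x]≈y : ∀ u v → u + (v - u) ≈ v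
      x+[y-x]≈y u v = trans (sym (+-assoc u v (- u)))
        (trans (+-congʳ (+-comm u v)) (trans (+-assoc _ _ _)
          (trans (+-congˡ (-‿inverseʳ u)) (+-identityʳ v))))

    P≈Bt : P ≈ B * t
    P≈Bt = t-central B

    tuB≈uP : ∀ u → t * u * B ≈ u * P
    tuB≈uP u = trans (*-congʳ (t-central u)) (*-assoc u t B)

    B*tu≈Pu : ∀ u → B * (t * u) ≈ P * u
    B*tu≈Pu u = trans (sym (*-assoc B t u)) (*-congʳ (sym P≈Bt))

    module _
      (B≈1+[z+y]P : B ≈ 1# + (z + y) * P)
      (B≈1+P[z+y] : B ≈ 1# + P * (z + y))
      (bZa≈t : b * Z * a ≈ t)
      (aZb≈t : a * Z * b ≈ t)
      where

      -- `a` exceeds the inverse 1 - t(z+y) of `B` by ty, and t y B = y P.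
      aB≈ : a * B ≈ 1# + y * P
      aB≈ = 1-*ˡ (begin
        B                            ≈⟨ B≈1+[z+y]P ⟩
        1# + (z + y) * P             ≈⟨ +-congˡ (distribʳ P z y) ⟩
        1# + (z * P + y * P)         ≈⟨ +-congˡ (+-comm _ _) ⟩
        1# + (y * P + z * P)         ≈⟨ sym (+-assoc _ _ _) ⟩
        1# + y * P + z * P           ≈⟨ +-congˡ (sym (tuB≈uP z)) ⟩
        1# + y * P + t * z * B       ∎)

      Ba≈ : B * a ≈ 1# + P * y
      Ba≈ = 1-*ʳ (begin
        B                            ≈⟨ B≈1+P[z+y] ⟩
        1# + P * (z + y)             ≈⟨ +-congˡ (distribˡ P z y) ⟩
        1# + (P * z + P * y)         ≈⟨ +-congˡ (+-comm _ _) ⟩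
        1# + (P * y + P * z)         ≈⟨ sym (+-assoc _ _ _) ⟩
        1# + P * y + P * z           ≈⟨ +-congˡ (sym (B*tu≈Pu z)) ⟩
        1# + P * y + B * (t * z)     ∎)

      z+z≈ : z + z ≈ x + (z + y)
      z+z≈ = trans (+-assoc x y z) (+-congˡ (+-comm y z))

      absorb : ∀ u v → 1# + u ≈ 1# - v + (v + u)
      absorb u v = begin
        1# + u                ≈⟨ +-congʳ (sym (+-identityʳ 1#)) ⟩
        1# + 0# + u           ≈⟨ +-congʳ (+-congˡ (sym (-‿inverseˡ v))) ⟩
        1# + (- v + v) + u    ≈⟨ +-congʳ (sym (+-assoc _ _ _)) ⟩
        1# - v + v + u        ≈⟨ +-assoc _ _ _ ⟩
        1# - v + (v + u)      ∎

      -- By `z+z≈`, `b` is the inverse 1 - t(z+y) of `B` diminished by tx.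
      bB≈ : b * B ≈ 1# - x * P
      bB≈ = 1-*ˡ (begin
        B                                      ≈⟨ B≈1+[z+y]P ⟩
        1# + (z + y) * P                       ≈⟨ absorb _ _ ⟩
        1# - x * P + (x * P + (z + y) * P)     ≈⟨ +-congˡ (sym (distribʳ P x (z + y))) ⟩
        1# - x * P + (x + (z + y)) * P         ≈⟨ +-congˡ (*-congʳ (sym z+z≈)) ⟩
        1# - x * P + (z + z) * P               ≈⟨ +-congˡ (sym (tuB≈uP (z + z))) ⟩
        1# - x * P + t * (z + z) * B           ∎)

      Bb≈ : B * b ≈ 1# - P * x
      Bb≈ = 1-*ʳ (begin
        B                                      ≈⟨ B≈1+P[z+y] ⟩
        1# + P * (z + y)                       ≈⟨ absorb _ _ ⟩
        1# - P * x + (P * x + P * (z + y))     ≈⟨ +-congˡ (sym (distribˡ P x (z + y))) ⟩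
        1# - P * x + P * (x + (z + y))         ≈⟨ +-congˡ (*-congˡ (sym z+z≈)) ⟩
        1# - P * x + P * (z + z)               ≈⟨ +-congˡ (sym (B*tu≈Pu (z + z))) ⟩
        1# - P * x + B * (t * (z + z))         ∎)

      A : Carrier
      A = 1# - t * (z + y)

      BA≈1 : B * A ≈ 1#
      BA≈1 = 1-*ʳ (trans B≈1+P[z+y] (+-congˡ (sym (B*tu≈Pu (z + y)))))

      AB≈1 : A * B ≈ 1#
      AB≈1 = 1-*ˡ (trans B≈1+[z+y]P (+-congˡ (sym (tuB≈uP (z + y)))))

      X≈aBx : X ≈ a * B * x
      X≈aBx = begin
        x + y * P * x            ≈⟨ +-congʳ (sym (*-identityˡ x)) ⟩
        1# * x + y * P * x       ≈⟨ sym (distribʳ x 1# (y * P)) ⟩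
        (1# + y * P) * x         ≈⟨ *-congʳ (sym aB≈) ⟩
        a * B * x                ∎

      Y≈yBb : Y ≈ y * B * b
      Y≈yBb = begin
        y - y * P * x            ≈⟨ +-cong (sym (*-identityʳ y)) (-‿cong (*-assoc y P x)) ⟩
        y * 1# - y * (P * x)     ≈⟨ sym (x[y-z]≈xy-xz y 1# (P * x)) ⟩
        y * (1# - P * x)         ≈⟨ *-congˡ (sym Bb≈) ⟩
        y * (B * b)              ≈⟨ sym (*-assoc y B b) ⟩
        y * B * b                ∎

      -- The push-through identity (1 + yP) y = y (1 + Py). It moves `y` past the product of `a` and
      -- `B`, although neither factor is assumed to commute with `y`.
      aBy≈yBa : a * B * y ≈ y * (B * a)
      aBy≈yBa = begin
        a * B * y                ≈⟨ *-congʳ aB≈ ⟩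
        (1# + y * P) * y         ≈⟨ distribʳ y 1# (y * P) ⟩
        1# * y + y * P * y       ≈⟨ +-cong (trans (*-identityˡ y) (sym (*-identityʳ y))) (*-assoc y P y) ⟩
        y * 1# + y * (P * y)     ≈⟨ sym (distribˡ y 1# (P * y)) ⟩
        y * (1# + P * y)         ≈⟨ *-congˡ (sym Ba≈) ⟩
        y * (B * a)              ∎

      x-xPx≈bBx : x - x * P * x ≈ b * B * x
      x-xPx≈bBx = begin
        x - x * P * x            ≈⟨ +-cong (sym (*-identityˡ x)) (-‿distribˡ-* (x * P) x) ⟩
        1# * x + - (x * P) * x   ≈⟨ sym (distribʳ x 1# _) ⟩
        (1# - x * P) * x         ≈⟨ *-congʳ (sym bB≈) ⟩
        b * B * x                ∎

      tBx≈ : y * B * t * B * x ≈ W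
      tBx≈ = begin
        y * B * t * B * x        ≈⟨ solve *-monoid ⟩
        y * B * (t * B) * x      ∎

      -- In the factored forms of `Y` and `X` the factors `b` and `a` stand next to `Z` and cancel
      -- its two denominators.
      YZX≈W : Y * Z * X ≈ W
      YZX≈W = begin
        Y * Z * X                       ≈⟨ *-cong (*-congʳ Y≈yBb) X≈aBx ⟩
        y * B * b * Z * (a * B * x)     ≈⟨ solve *-monoid ⟩
        y * B * (b * Z * a) * (B * x)   ≈⟨ *-congʳ (*-congˡ bZa≈t) ⟩
        y * B * t * (B * x)             ≈⟨ solve *-monoid ⟩
        y * B * t * B * x               ≈⟨ tBx≈ ⟩
        W                               ∎

      module _ (θ : Carrier) (θz≈zθ : θ * z ≈ z * θ) (θx≈ : θ * x ≈ x * θ + y * Z * x) where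

        private
          D : Carrier
          D = y * Z * x

        1-t*-comm : ∀ {u} → θ * u ≈ u * θ → θ * (1# - t * u) ≈ (1# - t * u) * θ
        1-t*-comm {u} e = begin
          θ * (1# - t * u)          ≈⟨ x[y-z]≈xy-xz θ 1# (t * u) ⟩
          θ * 1# - θ * (t * u)      ≈⟨ +-cong (trans (*-identityʳ θ) (sym (*-identityˡ θ))) (-‿cong θtu≈tuθ) ⟩
          1# * θ - t * u * θ        ≈⟨ +-congˡ (-‿distribˡ-* _ _) ⟩
          1# * θ + - (t * u) * θ    ≈⟨ sym (distribʳ θ 1# _) ⟩
          (1# - t * u) * θ          ∎
          where
          θtu≈tuθ : θ * (t * u) ≈ t * u * θ
          θtu≈tuθ = begin
            θ * (t * u)    ≈⟨ sym (*-assoc θ t u) ⟩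
            θ * t * u      ≈⟨ *-congʳ (sym (t-central θ)) ⟩
            t * θ * u      ≈⟨ *-assoc t θ u ⟩
            t * (θ * u)    ≈⟨ *-congˡ e ⟩
            t * (u * θ)    ≈⟨ sym (*-assoc t u θ) ⟩
            t * u * θ      ∎

        θa≈aθ : θ * a ≈ a * θ
        θa≈aθ = 1-t*-comm θz≈zθ

        θb≈bθ : θ * b ≈ b * θ
        θb≈bθ = 1-t*-comm (begin
          θ * (z + z)       ≈⟨ distribˡ θ z z ⟩
          θ * z + θ * z     ≈⟨ +-cong θz≈zθ θz≈zθ ⟩
          z * θ + z * θ     ≈⟨ sym (distribʳ θ z z) ⟩
          (z + z) * θ       ∎)

        -- `θ` commutes with `b`, a series in z, so this form reduces the commutator of `θ` with `A`
        -- to the one with `x`.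
        A≈b+tx : A ≈ b + t * x
        A≈b+tx = begin
          1# - t * (z + y)                          ≈⟨ absorb _ (t * x) ⟩
          1# - t * x + (t * x - t * (z + y))        ≈⟨ +-assoc _ _ _ ⟩
          1# + (- (t * x) + (t * x - t * (z + y)))  ≈⟨ +-congˡ (+-congˡ (+-comm _ _)) ⟩
          1# + (- (t * x) + (- (t * (z + y)) + t * x)) ≈⟨ +-congˡ (sym (+-assoc _ _ _)) ⟩
          1# + (- (t * x) - t * (z + y) + t * x)    ≈⟨ sym (+-assoc _ _ _) ⟩
          1# + (- (t * x) - t * (z + y)) + t * x    ≈⟨ +-congʳ (+-congˡ (-‿+-comm _ _)) ⟩
          1# - (t * x + t * (z + y)) + t * x        ≈⟨ +-congʳ (+-congˡ (-‿cong (sym (distribˡ t x (z + y))))) ⟩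
          1# - t * (x + (z + y)) + t * x            ≈⟨ +-congʳ (+-congˡ (-‿cong (*-congˡ (sym z+z≈)))) ⟩
          b + t * x                                 ∎

        θA≈Aθ+tD : θ * A ≈ A * θ + t * D
        θA≈Aθ+tD = begin
          θ * A                            ≈⟨ *-congˡ A≈b+tx ⟩
          θ * (b + t * x)                  ≈⟨ distribˡ θ b (t * x) ⟩
          θ * b + θ * (t * x)              ≈⟨ +-cong θb≈bθ (sym (*-assoc θ t x)) ⟩
          b * θ + θ * t * x                ≈⟨ +-congˡ (*-congʳ (sym (t-central θ))) ⟩
          b * θ + t * θ * x                ≈⟨ +-congˡ (*-assoc t θ x) ⟩
          b * θ + t * (θ * x)              ≈⟨ +-congˡ (*-congˡ θx≈) ⟩
          b * θ + t * (x * θ + D)          ≈⟨ +-congˡ (distribˡ t (x * θ) D) ⟩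
          b * θ + (t * (x * θ) + t * D)    ≈⟨ sym (+-assoc _ _ _) ⟩
          b * θ + t * (x * θ) + t * D      ≈⟨ +-congʳ (+-congˡ (sym (*-assoc t x θ))) ⟩
          b * θ + t * x * θ + t * D        ≈⟨ +-congʳ (sym (distribʳ θ b (t * x))) ⟩
          (b + t * x) * θ + t * D          ≈⟨ +-congʳ (*-congʳ (sym A≈b+tx)) ⟩
          A * θ + t * D                    ∎

        -- The derivative of an inverse, [θ, B] = - B [θ, A] B, written without the sign.
        Bθ≈θB+PDB : B * θ ≈ θ * B + P * D * B
        Bθ≈θB+PDB = begin
          B * θ                              ≈⟨ sym (*-identityʳ (B * θ)) ⟩
          B * θ * 1#                         ≈⟨ *-congˡ (sym AB≈1) ⟩
          B * θ * (A * B)                    ≈⟨ solve *-monoid ⟩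
          B * (θ * A) * B                    ≈⟨ *-congʳ (*-congˡ θA≈Aθ+tD) ⟩
          B * (A * θ + t * D) * B            ≈⟨ *-congʳ (distribˡ B (A * θ) (t * D)) ⟩
          (B * (A * θ) + B * (t * D)) * B    ≈⟨ distribʳ B _ _ ⟩
          B * (A * θ) * B + B * (t * D) * B  ≈⟨ +-cong BAθB (*-congʳ (B*tu≈Pu D)) ⟩
          θ * B + P * D * B                  ∎
          where
          BAθB : B * (A * θ) * B ≈ θ * B
          BAθB = *-congʳ (trans (sym (*-assoc B A θ)) (trans (*-congʳ BA≈1) (*-identityˡ θ)))

        -- The central `t` inside `P` moves to the right of `D`. Afterwards this term begins with
        -- `B`, like the term from [θ, x], and the two can be factored together.
        PDBx≈BDPx : P * D * B * x ≈ B * D * P * x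
        PDBx≈BDPx = *-congʳ (begin
          P * D * B            ≈⟨ *-congʳ (*-congʳ P≈Bt) ⟩
          B * t * D * B        ≈⟨ *-congʳ (*-assoc B t D) ⟩
          B * (t * D) * B      ≈⟨ *-congʳ (*-congˡ (t-central D)) ⟩
          B * (D * t) * B      ≈⟨ *-congʳ (sym (*-assoc B D t)) ⟩
          B * D * t * B        ≈⟨ *-assoc (B * D) t B ⟩
          B * D * P            ∎)

        aBD≈W+aPDBx : a * B * D ≈ W + a * (P * D * B * x)
        aBD≈W+aPDBx = begin
          a * B * D                                          ≈⟨ sym (+-identityʳ _) ⟩
          a * B * D + 0#                                     ≈⟨ +-congˡ (sym (-‿inverseˡ _)) ⟩
          a * B * D + (- (a * (P * D * B * x)) + a * (P * D * B * x)) ≈⟨ sym (+-assoc _ _ _) ⟩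
          a * B * D - a * (P * D * B * x) + a * (P * D * B * x) ≈⟨ +-congʳ difference ⟩
          W + a * (P * D * B * x)                            ∎
          where
          aBD≈ : a * B * (y * Z * x) ≈ a * B * y * Z * x
          aBD≈ = solve *-monoid

          aBDPx≈ : a * (B * (y * Z * x) * P * x) ≈ a * B * y * Z * (x * P * x)
          aBDPx≈ = solve *-monoid

          difference : a * B * D - a * (P * D * B * x) ≈ W
          difference = begin
            a * B * D - a * (P * D * B * x)               ≈⟨ +-congˡ (-‿cong (*-congˡ PDBx≈BDPx)) ⟩
            a * B * D - a * (B * D * P * x)               ≈⟨ +-cong aBD≈ (-‿cong aBDPx≈) ⟩
            a * B * y * Z * x - a * B * y * Z * (x * P * x) ≈⟨ sym (x[y-z]≈xy-xz (a * B * y * Z) x (x * P * x)) ⟩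
            -- After the push-through, `a` stands to the left of `Z` and the `b` of `x-xPx≈bBx` to
            -- its right; this is the order of `aZb≈t`, opposite to the one in `YZX≈W`.
            a * B * y * Z * (x - x * P * x)               ≈⟨ *-cong (*-congʳ aBy≈yBa) x-xPx≈bBx ⟩
            y * (B * a) * Z * (b * B * x)                 ≈⟨ solve *-monoid ⟩
            y * B * (a * Z * b) * (B * x)                 ≈⟨ *-congʳ (*-congˡ aZb≈t) ⟩
            y * B * t * (B * x)                           ≈⟨ solve *-monoid ⟩
            y * B * t * B * x                             ≈⟨ tBx≈ ⟩
            W                                             ∎

        -- From X = aBx and the commutation of `θ` with `a`, the commutator is a [θ, B] x + a B
        -- [θ, x]. The first summand is negative, so its opposite is added to both sides and
        -- cancelled at the end.
        θX≈Xθ+W : θ * X ≈ X * θ + W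
        θX≈Xθ+W = +-cancelʳ (a * (P * D * B * x)) _ _ (begin
          θ * X + a * (P * D * B * x)                  ≈⟨ +-cong θX≈aθBx aPDBx≈ ⟩
          a * (θ * B) * x + a * (P * D * B) * x        ≈⟨ sym (distribʳ x _ _) ⟩
          (a * (θ * B) + a * (P * D * B)) * x          ≈⟨ *-congʳ (sym (distribˡ a _ _)) ⟩
          a * (θ * B + P * D * B) * x                  ≈⟨ *-congʳ (*-congˡ (sym Bθ≈θB+PDB)) ⟩
          a * (B * θ) * x                              ≈⟨ solve *-monoid ⟩
          a * B * (θ * x)                              ≈⟨ *-congˡ θx≈ ⟩
          a * B * (x * θ + D)                          ≈⟨ distribˡ (a * B) (x * θ) D ⟩
          a * B * (x * θ) + a * B * D                  ≈⟨ +-cong (sym (*-assoc (a * B) x θ)) aBD≈W+aPDBx ⟩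
          a * B * x * θ + (W + a * (P * D * B * x))    ≈⟨ +-congʳ (*-congʳ (sym X≈aBx)) ⟩
          X * θ + (W + a * (P * D * B * x))            ≈⟨ sym (+-assoc _ _ _) ⟩
          X * θ + W + a * (P * D * B * x)              ∎)
          where
          aPDBx≈ : a * (P * D * B * x) ≈ a * (P * D * B) * x
          aPDBx≈ = sym (*-assoc _ _ _)

          θX≈aθBx : θ * X ≈ a * (θ * B) * x
          θX≈aθBx = begin
            θ * X               ≈⟨ *-congˡ X≈aBx ⟩
            θ * (a * B * x)     ≈⟨ solve *-monoid ⟩
            θ * a * (B * x)     ≈⟨ *-congʳ θa≈aθ ⟩
            a * θ * (B * x)     ≈⟨ solve *-monoid ⟩
            a * (θ * B) * x     ∎

      module _
        (N : Carrier → Carrier)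
        (N-cong : ∀ {f g} → f ≈ g → N f ≈ N g)
        (N-+ : ∀ f g → N (f + g) ≈ N f + N g)
        (N-* : ∀ f g → N (f * g) ≈ N f * g + f * N g)
        (N1≈0 : N 1# ≈ 0#) (Nx≈0 : N x ≈ 0#) (Ny≈0 : N y ≈ 0#) (Nt≈t : N t ≈ t)
        where

        N-constˡ : ∀ {f} g → N f ≈ 0# → N (f * g) ≈ f * N g
        N-constˡ g e = trans (N-* _ g) (trans (+-congʳ (trans (*-congʳ e) (zeroˡ g))) (+-identityˡ _))

        N-constʳ : ∀ f {g} → N g ≈ 0# → N (f * g) ≈ N f * g
        N-constʳ f e = trans (N-* f _) (trans (+-congˡ (trans (*-congˡ e) (zeroʳ f))) (+-identityʳ _))

        N-+-0 : ∀ {f g} → N f ≈ 0# → N (f + g) ≈ N g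
        N-+-0 e = trans (N-+ _ _) (trans (+-congʳ e) (+-identityˡ _))

        N[z+y]≈0 : N (z + y) ≈ 0#
        N[z+y]≈0 = trans (N-+-0 (trans (N-+-0 Nx≈0) Ny≈0)) Ny≈0

        -- Applying `N` to P = t + t(z+y)P gives a fixed-point equation for N P with the same
        -- operator and inhomogeneous term `P`; it is solved by multiplying with `B`.
        NP≈BP : N P ≈ B * P
        NP≈BP = begin
          N P                    ≈⟨ sym (*-identityˡ _) ⟩
          1# * N P               ≈⟨ *-congʳ (sym BA≈1) ⟩
          B * A * N P            ≈⟨ *-assoc B A (N P) ⟩
          B * (A * N P)          ≈⟨ *-congˡ (1-*ˡ NP≈P+) ⟩
          B * P                  ∎
          where
          NP≈P+ : N P ≈ P + t * (z + y) * N P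
          NP≈P+ = begin
            N P                           ≈⟨ N-* t B ⟩
            N t * B + t * N B             ≈⟨ +-cong (*-congʳ Nt≈t) (*-congˡ (trans (N-cong B≈1+[z+y]P) (N-+-0 N1≈0))) ⟩
            P + t * N ((z + y) * P)       ≈⟨ +-congˡ (*-congˡ (N-constˡ P N[z+y]≈0)) ⟩
            P + t * ((z + y) * N P)       ≈⟨ +-congˡ (sym (*-assoc t (z + y) (N P))) ⟩
            P + t * (z + y) * N P         ∎

        NX≈W : N X ≈ W
        NX≈W = begin
          N (x + y * P * x)    ≈⟨ N-+-0 Nx≈0 ⟩
          N (y * P * x)        ≈⟨ N-constʳ (y * P) Nx≈0 ⟩
          N (y * P) * x        ≈⟨ *-congʳ (N-constˡ P Ny≈0) ⟩
          y * N P * x          ≈⟨ *-congʳ (*-congˡ NP≈BP) ⟩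
          y * (B * P) * x      ≈⟨ *-congʳ (sym (*-assoc y B P)) ⟩
          W                    ∎

-- The power rule for the logarithmic derivative.

module LogarithmicDerivative {c ℓ} (S : Ring c ℓ) where
  open Ring S
  open import Algebra.Properties.Semiring.Exp semiring
  open import Algebra.Properties.Semiring.Mult semiring
  open import Relation.Binary.Reasoning.Setoid setoid

  module _
    (N : Carrier → Carrier)
    (N-* : ∀ f g → N (f * g) ≈ N f * g + f * N g)
    (N1≈0 : N 1# ≈ 0#)
    where

    -- The ordinary power rule survives because `N Ψ` is `θ` times a polynomial in `Ψ`, and `θ`
    -- commutes with `Ψ`. The factor 1 + Ψ is what produces two adjacent exponents.
    N-^ : ∀ {θ Ψ} → θ * Ψ ≈ Ψ * θ → N Ψ ≈ θ * (1# + Ψ) →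
          ∀ d → N (Ψ ^ suc d) ≈ suc d × (θ * (Ψ ^ d + Ψ ^ suc d))
    N-^ {θ} {Ψ} θΨ≈Ψθ NΨ≈ d = trans (N-* Ψ (Ψ ^ d)) (+-cong first (second d))
      where
      first : N Ψ * Ψ ^ d ≈ θ * (Ψ ^ d + Ψ ^ suc d)
      first = begin
        N Ψ * Ψ ^ d                      ≈⟨ *-congʳ NΨ≈ ⟩
        θ * (1# + Ψ) * Ψ ^ d             ≈⟨ *-assoc _ _ _ ⟩
        θ * ((1# + Ψ) * Ψ ^ d)           ≈⟨ *-congˡ (distribʳ _ _ _) ⟩
        θ * (1# * Ψ ^ d + Ψ * Ψ ^ d)     ≈⟨ *-congˡ (+-congʳ (*-identityˡ _)) ⟩
        θ * (Ψ ^ d + Ψ ^ suc d)          ∎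

      second : ∀ d → Ψ * N (Ψ ^ d) ≈ d × (θ * (Ψ ^ d + Ψ ^ suc d))
      second zero    = trans (*-congˡ N1≈0) (zeroʳ Ψ)
      second (suc d) = begin
        Ψ * N (Ψ ^ suc d)                          ≈⟨ *-congˡ (N-^ θΨ≈Ψθ NΨ≈ d) ⟩
        Ψ * (suc d × (θ * (Ψ ^ d + Ψ ^ suc d)))    ≈⟨ ×-comm-* (suc d) Ψ _ ⟩
        suc d × (Ψ * (θ * (Ψ ^ d + Ψ ^ suc d)))    ≈⟨ ×-congʳ (suc d) shifted ⟩
        suc d × (θ * (Ψ ^ suc d + Ψ ^ suc (suc d))) ∎
        where
        shifted : Ψ * (θ * (Ψ ^ d + Ψ ^ suc d)) ≈ θ * (Ψ ^ suc d + Ψ ^ suc (suc d))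
        shifted = begin
          Ψ * (θ * (Ψ ^ d + Ψ ^ suc d))    ≈⟨ sym (*-assoc Ψ θ _) ⟩
          Ψ * θ * (Ψ ^ d + Ψ ^ suc d)      ≈⟨ *-congʳ (sym θΨ≈Ψθ) ⟩
          θ * Ψ * (Ψ ^ d + Ψ ^ suc d)      ≈⟨ *-assoc θ Ψ _ ⟩
          θ * (Ψ * (Ψ ^ d + Ψ ^ suc d))    ≈⟨ *-congˡ (distribˡ Ψ _ _) ⟩
          θ * (Ψ ^ suc d + Ψ ^ suc (suc d)) ∎

-- Functionals on free modules

open import Defs
open import Data.Bool.Base using (if_then_else_; true; false)
open import Data.Integer.Base as ℤ using (ℤ; +_; -1ℤ)
import Data.Integer.Properties as ℤ
open import Data.List.Base using (List; []; _∷_; _++_; [_]; _∷ʳ_; initLast; _∷ʳ′_; map; concatMap; applyUpTo; upTo)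
import Data.List.Properties as List
open import Data.Product.Base using (_×_)
open import Data.List.Reverse using (Reverse; []; _∶_∶ʳ_; reverseView)
open import Data.Rational.Base as ℚ using (ℚ; 0ℚ; 1ℚ; _/_)
import Data.Rational.Properties as ℚ
open import Data.Rational.Unnormalised.Base as ℚᵘ using (mkℚᵘ; *≡*)
import Data.Rational.Unnormalised.Properties as ℚᵘ
open import Data.Vec.Base using (_∷_)
open import Relation.Nullary.Decidable using (does)
open ≡ using (refl; sym; trans; cong; cong₂; module ≡-Reasoning)
open import Algebra.Properties.CommutativeSemigroup (CommutativeMonoid.commutativeSemigroup ℚ.+-0-commutativeMonoid)
  using () renaming (interchange to +-interchange)
open import Algebra.Properties.CommutativeSemigroup (CommutativeMonoid.commutativeSemigroup ℚ.*-1-commutativeMonoid)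
  using () renaming (x∙yz≈y∙xz to x*yz≡y*xz)
open import Algebra.Properties.Group ℚ.+-0-group
  using () renaming (∙-cancelˡ to +-cancelˡ; ⁻¹-involutive to neg-involutive)

open Convolution ℚ.+-0-commutativeMonoid using (conv; conv-cong; conv-cong-+; conv-ε)

-- The linear extension of φ.  Elements are compared by their images under all
-- such φ: this implies _≈_ (coeff≡eval) and, unlike _≈_, is respected by lin
-- for trivial reasons.
opaque
  eval : {B : Set} → Free B → (B → ℚ) → ℚ
  eval []            φ = 0ℚ
  eval ((c , b) ∷ p) φ = c ℚ.* φ b ℚ.+ eval p φ

  eval-[] : ∀ {B : Set} (φ : B → ℚ) → eval [] φ ≡ 0ℚ
  eval-[] φ = refl

  eval-cong : ∀ {B : Set} (p : Free B) {φ ψ} → (∀ b → φ b ≡ ψ b) → eval p φ ≡ eval p ψ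
  eval-cong []            e = refl
  eval-cong ((c , b) ∷ p) e = cong₂ (λ s r → c ℚ.* s ℚ.+ r) (e b) (eval-cong p e)

  eval-++ : ∀ {B : Set} (p q : Free B) φ → eval (p ++ q) φ ≡ eval p φ ℚ.+ eval q φ
  eval-++ []            q φ = sym (ℚ.+-identityˡ _)
  eval-++ ((c , b) ∷ p) q φ = trans (cong (c ℚ.* φ b ℚ.+_) (eval-++ p q φ))
    (sym (ℚ.+-assoc (c ℚ.* φ b) (eval p φ) (eval q φ)))

  eval-*ₗ : ∀ {B : Set} c (p : Free B) φ → eval (c *ₗ p) φ ≡ c ℚ.* eval p φ
  eval-*ₗ c []            φ = sym (ℚ.*-zeroʳ c)
  eval-*ₗ c ((d , b) ∷ p) φ = trans
    (cong₂ ℚ._+_ (ℚ.*-assoc c d (φ b)) (eval-*ₗ c p φ))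
    (sym (ℚ.*-distribˡ-+ c _ _))

  eval-η : ∀ {B : Set} (b : B) φ → eval (η b) φ ≡ φ b
  eval-η b φ = trans (ℚ.+-identityʳ _) (ℚ.*-identityˡ (φ b))

  eval-0 : ∀ {B : Set} (p : Free B) → eval p (λ _ → 0ℚ) ≡ 0ℚ
  eval-0 []            = refl
  eval-0 ((c , b) ∷ p) = trans (cong₂ ℚ._+_ (ℚ.*-zeroʳ c) (eval-0 p)) (ℚ.+-identityˡ 0ℚ)

  eval-+ : ∀ {B : Set} (p : Free B) φ ψ → eval p (λ b → φ b ℚ.+ ψ b) ≡ eval p φ ℚ.+ eval p ψ
  eval-+ []            φ ψ = refl
  eval-+ ((c , b) ∷ p) φ ψ = trans
    (cong₂ ℚ._+_ (ℚ.*-distribˡ-+ c (φ b) (ψ b)) (eval-+ p φ ψ))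
    (+-interchange (c ℚ.* φ b) _ _ _)

  eval-* : ∀ {B : Set} (p : Free B) c φ → eval p (λ b → c ℚ.* φ b) ≡ c ℚ.* eval p φ
  eval-* []            c φ = sym (ℚ.*-zeroʳ c)
  eval-* ((d , b) ∷ p) c φ = trans
    (cong₂ ℚ._+_ (trans (sym (ℚ.*-assoc d c (φ b)))
      (trans (cong (ℚ._* φ b) (ℚ.*-comm d c)) (ℚ.*-assoc c d (φ b)))) (eval-* p c φ))
    (sym (ℚ.*-distribˡ-+ c _ _))

  eval-conv : ∀ {B : Set} (p : Free B) (K : B → ℕ → ℕ → ℚ) n →
    eval p (λ b → conv (K b) n) ≡ conv (λ i j → eval p (λ b → K b i j)) n
  eval-conv p K zero    = refl
  eval-conv p K (suc n) = trans (eval-+ p _ _)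
    (cong (eval p _ ℚ.+_) (eval-conv p (λ b i → K b (suc i)) n))

  eval-lin : ∀ {B C : Set} (h : C → Free B) (p : Free C) φ →
    eval (lin h p) φ ≡ eval p (λ c → eval (h c) φ)
  eval-lin h []            φ = refl
  eval-lin h ((c , b) ∷ p) φ = trans (eval-++ (c *ₗ h b) (lin h p) φ)
    (cong₂ ℚ._+_ (eval-*ₗ c (h b) φ) (eval-lin h p φ))

  eval-swap : ∀ {B C : Set} (p : Free B) (q : Free C) (K : B → C → ℚ) →
    eval p (λ b → eval q (K b)) ≡ eval q (λ c → eval p (λ b → K b c))
  eval-swap []            q K = sym (eval-0 q)
  eval-swap ((c , b) ∷ p) q K = trans
    (cong₂ ℚ._+_ (sym (eval-* q c (K b))) (eval-swap p q K)) (sym (eval-+ q _ _))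

  coeff≡eval : ∀ p w → coeff p w ≡ eval p (λ v → if does (v ≟ᵂ w) then 1ℚ else 0ℚ)
  coeff≡eval []            w = refl
  coeff≡eval ((c , v) ∷ p) w with does (v ≟ᵂ w)
  ... | true  = cong₂ ℚ._+_ (sym (ℚ.*-identityʳ c)) (coeff≡eval p w)
  ... | false = cong₂ ℚ._+_ (sym (ℚ.*-zeroʳ c)) (coeff≡eval p w)

eval-M⊗ : ∀ p q φ → eval (M (p ⊗ q)) φ ≡ eval p (λ v → eval q (λ w → φ (v ++ w)))
eval-M⊗ p q φ = trans (eval-lin (λ (v , w) → η (v ++ w)) (p ⊗ q) φ)
  (trans (eval-lin (λ v → lin (λ w → η (v , w)) q) p _)
  (eval-cong p λ v → trans (eval-lin (λ w → η (v , w)) q _)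
    (eval-cong q λ w → trans (eval-η (v , w) _) (eval-η (v ++ w) φ))))

-- Linear endomorphisms of 𝔥

Endo : Set
Endo = Word → 𝔥

infix 4 _≐_
record _≐_ (F G : Endo) : Set where
  constructor wordwise
  field on : ∀ w φ → eval (F w) φ ≡ eval (G w) φ
open _≐_ public

_⊕_ : Endo → Endo → Endo
(F ⊕ G) w = F w +ᴹ G w

opaque
  _∘ᴱ_ : Endo → Endo → Endo
  (F ∘ᴱ G) w = lin F (G w)

  eval-∘ : ∀ F G w φ → eval ((F ∘ᴱ G) w) φ ≡ eval (G w) (λ v → eval (F v) φ)
  eval-∘ F G w φ = eval-lin F (G w) φ

⊖_ : Endo → Endo
(⊖ F) w = (ℚ.- 1ℚ) *ₗ F w

0ᴱ : Endo
0ᴱ w = 0ᴹ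

endoRing : Ring _ _
endoRing = record
  { Carrier = Endo
  ; _≈_     = _≐_
  ; _+_     = _⊕_
  ; _*_     = _∘ᴱ_
  ; -_      = ⊖_
  ; 0#      = 0ᴱ
  ; 1#      = η
  ; isRing  = record
    { +-isAbelianGroup = record
      { isGroup = record
        { isMonoid = record
          { isSemigroup = record
            { isMagma = record
              { isEquivalence = record
                { refl  = wordwise λ _ _ → refl
                ; sym   = λ e → wordwise λ w φ → sym (on e w φ)
                ; trans = λ e e′ → wordwise λ w φ → trans (on e w φ) (on e′ w φ)
                }
              ; ∙-cong = λ {F} {F′} {G} {G′} e e′ → wordwise λ w φ → trans (eval-++ (F w) (G w) φ)
                  (trans (cong₂ ℚ._+_ (on e w φ) (on e′ w φ)) (sym (eval-++ (F′ w) (G′ w) φ)))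
              }
            ; assoc = λ F G H → wordwise λ w φ → cong (λ p → eval p φ) (List.++-assoc (F w) (G w) (H w))
            }
          ; identity = (λ F → wordwise λ w φ → refl)
                     , (λ F → wordwise λ w φ → cong (λ p → eval p φ) (List.++-identityʳ (F w)))
          }
        ; inverse = (λ F → wordwise λ w φ → inverseˡ (F w) φ)
                  , (λ F → wordwise λ w φ → trans (+ᴹ-comm (F w) ((ℚ.- 1ℚ) *ₗ F w) φ) (inverseˡ (F w) φ))
        ; ⁻¹-cong = λ {F} {G} e → wordwise λ w φ → trans (eval-*ₗ (ℚ.- 1ℚ) (F w) φ)
            (trans (cong ((ℚ.- 1ℚ) ℚ.*_) (on e w φ)) (sym (eval-*ₗ (ℚ.- 1ℚ) (G w) φ)))
        }
      ; comm = λ F G → wordwise λ w φ → +ᴹ-comm (F w) (G w) φ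
      }
    ; *-cong     = λ {F} {F′} {G} {G′} e e′ → wordwise λ w φ → trans (eval-∘ F G w φ)
        (trans (on e′ w _) (trans (eval-cong (G′ w) (λ v → on e v φ)) (sym (eval-∘ F′ G′ w φ))))
    ; *-assoc    = λ F G H → wordwise λ w φ → trans (eval-∘ (F ∘ᴱ G) H w φ)
        (trans (eval-cong (H w) (λ v → eval-∘ F G v φ))
          (sym (trans (eval-∘ F (G ∘ᴱ H) w φ) (eval-∘ G H w _))))
    ; *-identity = (λ F → wordwise λ w φ → trans (eval-∘ η F w φ) (eval-cong (F w) (λ v → eval-η v φ)))
                 , (λ F → wordwise λ w φ → trans (eval-∘ F η w φ) (eval-η w _))
    ; distrib    = (λ F G H → wordwise λ w φ → trans (eval-∘ F (G ⊕ H) w φ) (trans (eval-++ (G w) (H w) _)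
                     (sym (trans (eval-++ ((F ∘ᴱ G) w) ((F ∘ᴱ H) w) φ)
                       (cong₂ ℚ._+_ (eval-∘ F G w φ) (eval-∘ F H w φ))))))
                 , (λ F G H → wordwise λ w φ → trans (eval-∘ (G ⊕ H) F w φ)
                     (trans (eval-cong (F w) (λ v → eval-++ (G v) (H v) φ)) (trans (eval-+ (F w) _ _)
                       (sym (trans (eval-++ ((G ∘ᴱ F) w) ((H ∘ᴱ F) w) φ)
                         (cong₂ ℚ._+_ (eval-∘ G F w φ) (eval-∘ H F w φ)))))))
    }
  }
  where
  +ᴹ-comm : ∀ (p q : 𝔥) φ → eval (p +ᴹ q) φ ≡ eval (q +ᴹ p) φ
  +ᴹ-comm p q φ = trans (eval-++ p q φ)
    (trans (ℚ.+-comm (eval p φ) (eval q φ)) (sym (eval-++ q p φ)))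

  inverseˡ : ∀ (p : 𝔥) φ → eval ((ℚ.- 1ℚ) *ₗ p +ᴹ p) φ ≡ eval 0ᴹ φ
  inverseˡ p φ = trans (eval-++ ((ℚ.- 1ℚ) *ₗ p) p φ) (trans
    (cong (ℚ._+ eval p φ) (trans (eval-*ₗ (ℚ.- 1ℚ) p φ)
      (trans (sym (ℚ.neg-distribˡ-* 1ℚ (eval p φ))) (cong ℚ.-_ (ℚ.*-identityˡ (eval p φ))))))
    (trans (ℚ.+-inverseˡ (eval p φ)) (sym (eval-[] φ))))

open PowerSeries endoRing hiding (ring)

module E = Ring endoRing
module S = Ring (PowerSeries.ring endoRing)
open import Algebra.Properties.Semiring.Exp E.semiring using () renaming (_^_ to _^ᴱ_)
open import Algebra.Properties.Semiring.Exp S.semiring using () renaming (_^_ to _^ˢ_)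
open import Algebra.Properties.Semiring.Mult E.semiring using ()
  renaming (_×_ to _×ᴱ_; ×-comm-* to ×ᴱ-comm-*; ×-assoc-* to ×ᴱ-assoc-*;
            ×-congˡ to ×ᴱ-congˡ; ×-congʳ to ×ᴱ-congʳ; ×-homo-+ to ×ᴱ-homo-+)
open import Algebra.Properties.Semiring.Mult S.semiring using () renaming (_×_ to _×ˢ_)
open import Algebra.Properties.CommutativeMonoid.Mult E.+-commutativeMonoid using ()
  renaming (×-distrib-+ to ×ᴱ-distrib-+)

-- Composition reverses products: the operator right b E.* right a is right
-- multiplication by a b (right-*).
right : 𝔥 → Endo
right p w = lin (λ v → η (w ++ v)) p

eval-right : ∀ p w φ → eval (right p w) φ ≡ eval p (λ v → φ (w ++ v))
eval-right p w φ = trans (eval-lin (λ v → η (w ++ v)) p φ) (eval-cong p (λ v → eval-η (w ++ v) φ))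

right-* : ∀ p q → right (p * q) E.≈ right q E.* right p
right-* p q = wordwise λ w φ → begin
  eval (right (p * q) w) φ                              ≡⟨ eval-right (p * q) w φ ⟩
  eval (p * q) (λ v → φ (w ++ v))                       ≡⟨ eval-M⊗ p q _ ⟩
  eval p (λ u → eval q (λ v → φ (w ++ (u ++ v))))       ≡⟨ eval-cong p (λ u → eval-cong q (λ v → cong φ (List.++-assoc w u v))) ⟨
  eval p (λ u → eval q (λ v → φ ((w ++ u) ++ v)))       ≡⟨ eval-cong p (λ u → eval-right q (w ++ u) φ) ⟨
  eval p (λ u → eval (right q (w ++ u)) φ)              ≡⟨ eval-right p w _ ⟨
  eval (right p w) (λ v → eval (right q v) φ)           ≡⟨ eval-∘ (right q) (right p) w φ ⟨
  eval ((right q E.* right p) w) φ                    ∎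
  where open ≡-Reasoning

right-1 : right (η []) E.≈ E.1#
right-1 = wordwise λ w φ → trans (eval-right (η []) w φ) (trans (eval-η [] _)
  (trans (cong φ (List.++-identityʳ w)) (sym (eval-η w φ))))

eval-⋆ : ∀ (F G : ℕ → Endo) n w φ →
  eval ((F ⋆ G) n w) φ ≡ conv (λ i j → eval (G j w) (λ v → eval (F i v) φ)) n
eval-⋆ F G n w φ = trans (cong (λ H → eval (H w) φ) (⋆-coefficient F G n)) (go F n)
  where
  open Convolution E.+-commutativeMonoid using () renaming (conv to convᴱ)
  go : ∀ F n → eval (convᴱ (λ i j → F i E.* G j) n w) φ ≡ conv (λ i j → eval (G j w) (λ v → eval (F i v) φ)) n
  go F zero    = eval-∘ (F 0) (G 0) w φ
  go F (suc n) = trans (eval-++ ((F 0 E.* G (suc n)) w) _ φ)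
    (cong₂ ℚ._+_ (eval-∘ (F 0) (G (suc n)) w φ) (go (λ i → F (suc i)) n))

-- The coproduct and the extension of rooted tree maps to words

eval-Δ-∷ : ∀ f g K → eval (Δ (B₊ f ∷ g)) K ≡
  eval (Δ g) (λ (h₁ , h₂) → K (B₊ f ∷ h₁ , h₂)) ℚ.+
  eval (Δ f) (λ (f₁ , f₂) → eval (Δ g) (λ (h₁ , h₂) → K (f₁ ++ h₁ , B₊ f₂ ∷ h₂)))
eval-Δ-∷ f g K = begin
  eval (lin timesΔg (whole +ᴹ id⊗B₊ (Δ f))) K
    ≡⟨ eval-lin timesΔg (whole +ᴹ id⊗B₊ (Δ f)) K ⟩
  eval (whole +ᴹ id⊗B₊ (Δ f)) K′
    ≡⟨ eval-++ whole (id⊗B₊ (Δ f)) K′ ⟩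
  eval whole K′ ℚ.+ eval (id⊗B₊ (Δ f)) K′
    ≡⟨ cong₂ ℚ._+_ (eval-η ([ B₊ f ] , []) K′)
         (trans (eval-lin graft (Δ f) K′) (eval-cong (Δ f) λ (f₁ , f₂) → eval-η (f₁ , [ B₊ f₂ ]) K′)) ⟩
  K′ ([ B₊ f ] , []) ℚ.+ eval (Δ f) (λ (f₁ , f₂) → K′ (f₁ , [ B₊ f₂ ]))
    ≡⟨ cong₂ ℚ._+_ (product [ B₊ f ] []) (eval-cong (Δ f) λ (f₁ , f₂) → product f₁ [ B₊ f₂ ]) ⟩
  _ ∎
  where
  open ≡-Reasoning
  whole : Free (Forest × Forest)
  whole = η ([ B₊ f ] , [])

  graft timesΔg : Forest × Forest → Free (Forest × Forest)
  graft   (f₁ , f₂) = η (f₁ , [ B₊ f₂ ])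
  timesΔg (g₁ , g₂) = lin (λ (h₁ , h₂) → η (g₁ ++ h₁ , g₂ ++ h₂)) (Δ g)

  K′ : Forest × Forest → ℚ
  K′ g₁₂ = eval (timesΔg g₁₂) K

  product : ∀ g₁ g₂ → K′ (g₁ , g₂) ≡ eval (Δ g) (λ (h₁ , h₂) → K (g₁ ++ h₁ , g₂ ++ h₂))
  product g₁ g₂ = trans (eval-lin (λ (h₁ , h₂) → η (g₁ ++ h₁ , g₂ ++ h₂)) (Δ g) K)
    (eval-cong (Δ g) λ (h₁ , h₂) → eval-η (g₁ ++ h₁ , g₂ ++ h₂) K)

-- Ladders form a divided-power sequence: Δ(λₘ) is the sum of λᵢ ⊗ λⱼ over i + j = m. The
-- convolution is indexed by j first, since the recursion of Δ makes the right factor grow.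
eval-Δ-ladder : ∀ m K → eval (Δ (ladder m)) K ≡ conv (λ j i → K (ladder i , ladder j)) m
eval-Δ-ladder zero    K = eval-η ([] , []) K
eval-Δ-ladder (suc m) K = trans (eval-Δ-∷ (ladder m) [] K) (cong₂ ℚ._+_
  (eval-η ([] , []) _)
  (trans (eval-cong (Δ (ladder m)) λ (f₁ , f₂) → trans (eval-η ([] , []) _)
      (cong (λ f → K (f , [ B₊ f₂ ])) (List.++-identityʳ f₁)))
    (eval-Δ-ladder m _)))

eval-Δ-ladder-++ : ∀ m g K → eval (Δ (ladder m ++ g)) K ≡
  conv (λ j i → eval (Δ g) (λ (h₁ , h₂) → K (ladder i ++ h₁ , ladder j ++ h₂))) m
eval-Δ-ladder-++ zero    g K = refl
eval-Δ-ladder-++ (suc m) g K = trans (eval-Δ-∷ (ladder m) g K)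
  (cong (eval (Δ g) _ ℚ.+_) (eval-Δ-ladder m _))

wordMap-[] : ∀ w → wordMap [] w ≡ η w
wordMap-[] w = cong η (List.reverse-involutive w)

eval-wordMap-∷ʳ : ∀ f w u φ → eval (wordMap f (w ∷ʳ u)) φ ≡
  eval (Δ f) (λ (f₁ , f₂) → eval (wordMap f₁ w) (λ v₁ → eval (letterMap f₂ u) (λ v₂ → φ (v₁ ++ v₂))))
eval-wordMap-∷ʳ [] w u φ = begin
  eval (wordMap [] (w ∷ʳ u)) φ    ≡⟨ cong (λ p → eval p φ) (wordMap-[] (w ∷ʳ u)) ⟩
  eval (η (w ∷ʳ u)) φ             ≡⟨ eval-η (w ∷ʳ u) φ ⟩
  φ (w ∷ʳ u)                      ≡⟨ eval-η [ u ] _ ⟨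
  eval ⟨ u ⟩ (λ v → φ (w ++ v))   ≡⟨ eval-η w _ ⟨
  eval (η w) (λ v₁ → eval ⟨ u ⟩ (λ v₂ → φ (v₁ ++ v₂)))
    ≡⟨ cong (λ p → eval p (λ v₁ → eval ⟨ u ⟩ (λ v₂ → φ (v₁ ++ v₂)))) (wordMap-[] w) ⟨
  eval (wordMap [] w) (λ v₁ → eval ⟨ u ⟩ (λ v₂ → φ (v₁ ++ v₂)))
    ≡⟨ eval-η ([] , []) _ ⟨
  eval (Δ []) _ ∎
  where open ≡-Reasoning
eval-wordMap-∷ʳ f@(t ∷ f′) w u φ = trans (cong (λ p → eval p φ) (wordMap-∷ʳ t f′ w u))
  (trans (eval-lin (λ (f₁ , f₂) → M (wordMap f₁ w ⊗ letterMap f₂ u)) (Δ f) φ)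
    (eval-cong (Δ f) λ (f₁ , f₂) → eval-M⊗ (wordMap f₁ w) (letterMap f₂ u) φ))

-- The series of ladder maps and its multiplicativity.

Φ : ℕ → Endo
Φ m = wordMap (ladder m)

letterSeries : Letter → ℕ → Endo
letterSeries u m = right (letterMap (ladder m) u)

eval-Φ-∷ʳ : ∀ m w u φ → eval (Φ m (w ∷ʳ u)) φ ≡
  conv (λ j i → eval (Φ i w) (λ v₁ → eval (letterMap (ladder j) u) (λ v₂ → φ (v₁ ++ v₂)))) m
eval-Φ-∷ʳ m w u φ = trans (eval-wordMap-∷ʳ (ladder m) w u φ) (eval-Δ-ladder m _)

letterˢ : Letter → ℕ → Endo
letterˢ u = const (right ⟨ u ⟩)

xˢ yˢ : ℕ → Endo
xˢ = letterˢ x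
yˢ = letterˢ y

⋆letter : ∀ F u n w φ → eval ((F ⋆ letterˢ u) n w) φ ≡ eval (F n (w ∷ʳ u)) φ
⋆letter F u n w φ = trans (on (⋆const (right ⟨ u ⟩) F n) w φ)
  (trans (eval-∘ (F n) (right ⟨ u ⟩) w φ) (trans (eval-right ⟨ u ⟩ w _) (eval-η [ u ] _)))

-- By the coproduct of ladders, the rule for f(wu) becomes Φ(wu) = Φ(w) Φ(u); right multiplication
-- by Φ(u) is `letterSeries u`.
Φ-letter : ∀ u → Φ S.* letterˢ u S.≈ letterSeries u S.* Φ
Φ-letter u = coefficientwise λ m → wordwise λ w φ → trans (⋆letter Φ u m w φ) (trans (eval-Φ-∷ʳ m w u φ)
  (trans (conv-cong m (λ j i → eval-cong (Φ i w) (λ v → sym (eval-right (letterMap (ladder j) u) v φ))))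
    (sym (eval-⋆ (letterSeries u) Φ m w φ))))

wordSeries : Word → ℕ → Endo
wordSeries w m = right (Φ m w)

wordSeries-∷ʳ : ∀ w u → letterSeries u S.* wordSeries w S.≈ wordSeries (w ∷ʳ u)
wordSeries-∷ʳ w u = coefficientwise λ m → wordwise λ v φ → begin
  eval ((letterSeries u ⋆ wordSeries w) m v) φ
    ≡⟨ eval-⋆ (letterSeries u) (wordSeries w) m v φ ⟩
  conv (λ j i → eval (right (Φ i w) v) (λ v′ → eval (right (letterMap (ladder j) u) v′) φ)) m
    ≡⟨ conv-cong m (λ j i → trans (eval-right (Φ i w) v _) (eval-cong (Φ i w) λ v₁ →
         trans (eval-right (letterMap (ladder j) u) (v ++ v₁) φ) (eval-cong (letterMap (ladder j) u) λ v₂ →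
           cong φ (List.++-assoc v v₁ v₂)))) ⟩
  conv (λ j i → eval (Φ i w) (λ v₁ → eval (letterMap (ladder j) u) (λ v₂ → φ (v ++ (v₁ ++ v₂))))) m
    ≡⟨ eval-Φ-∷ʳ m w u _ ⟨
  eval (Φ m (w ∷ʳ u)) (λ v′ → φ (v ++ v′))
    ≡⟨ eval-right (Φ m (w ∷ʳ u)) v φ ⟨
  eval (wordSeries (w ∷ʳ u) m v) φ ∎
  where open ≡-Reasoning

-- Multiplicativity Φ(vw) = Φ(v) Φ(w) with v as the operand. The induction removes the last letter,
-- the one that `Φ-letter` can handle.
Φ-word : ∀ w → Φ S.* const (right (η w)) S.≈ wordSeries w S.* Φ
Φ-word w = go (reverseView w)
  where
  go : ∀ {w} → Reverse w → Φ S.* const (right (η w)) S.≈ wordSeries w S.* Φ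
  go [] = begin
    Φ S.* const (right (η []))   ≈⟨ S.*-congˡ (const-cong right-1) ⟩
    Φ S.* S.1#                   ≈⟨ S.*-identityʳ Φ ⟩
    Φ                            ≈⟨ S.*-identityˡ Φ ⟨
    S.1# S.* Φ                   ≈⟨ S.*-congʳ (coefficientwise λ { zero → right-1 ; (suc n) → E.refl }) ⟨
    wordSeries [] S.* Φ          ∎
    where open import Relation.Binary.Reasoning.Setoid S.setoid
  go (w ∶ r ∶ʳ u) = begin
    Φ S.* const (right (η (w ∷ʳ u)))                   ≈⟨ S.*-congˡ split ⟩
    Φ S.* (letterˢ u S.* const (right (η w)))             ≈⟨ S.*-assoc Φ (letterˢ u) _ ⟨
    Φ S.* letterˢ u S.* const (right (η w))               ≈⟨ S.*-congʳ (Φ-letter u) ⟩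
    letterSeries u S.* Φ S.* const (right (η w))       ≈⟨ S.*-assoc (letterSeries u) Φ _ ⟩
    letterSeries u S.* (Φ S.* const (right (η w)))     ≈⟨ S.*-congˡ (go r) ⟩
    letterSeries u S.* (wordSeries w S.* Φ)            ≈⟨ S.*-assoc (letterSeries u) (wordSeries w) Φ ⟨
    letterSeries u S.* wordSeries w S.* Φ              ≈⟨ S.*-congʳ (wordSeries-∷ʳ w u) ⟩
    wordSeries (w ∷ʳ u) S.* Φ                          ∎
    where
    open import Relation.Binary.Reasoning.Setoid S.setoid
    split : const (right (η (w ∷ʳ u))) S.≈ letterˢ u S.* const (right (η w))
    split = S.trans (const-cong (wordwise λ v φ → trans
        (trans (eval-right (η (w ∷ʳ u)) v φ) (trans (eval-η (w ∷ʳ u) _) (cong φ (sym (List.++-assoc v w [ u ])))))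
        (sym (trans (eval-∘ (right ⟨ u ⟩) (right (η w)) v φ) (trans (eval-right (η w) v _)
          (trans (eval-η w _) (trans (eval-right ⟨ u ⟩ (v ++ w) φ) (eval-η [ u ] _))))))))
      (const-* (right ⟨ u ⟩) (right (η w)))

eval-Φ-++ : ∀ m v w φ → eval (Φ m (v ++ w)) φ ≡
  conv (λ j i → eval (Φ i v) (λ v₁ → eval (Φ j w) (λ v₂ → φ (v₁ ++ v₂)))) m
eval-Φ-++ m v w φ = begin
  eval (Φ m (v ++ w)) φ                         ≡⟨ eval-η w _ ⟨
  eval (η w) (λ w → eval (Φ m (v ++ w)) φ)      ≡⟨ eval-right (η w) v _ ⟨
  eval (right (η w) v) (λ v → eval (Φ m v) φ)   ≡⟨ eval-∘ (Φ m) (right (η w)) v φ ⟨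
  eval ((Φ m E.* right (η w)) v) φ              ≡⟨ on (⋆const (right (η w)) Φ m) v φ ⟨
  eval ((Φ ⋆ const (right (η w))) m v) φ        ≡⟨ on (at (Φ-word w) m) v φ ⟩
  eval ((wordSeries w ⋆ Φ) m v) φ               ≡⟨ eval-⋆ (wordSeries w) Φ m v φ ⟩
  conv (λ j i → eval (Φ i v) (λ v₁ → eval (right (Φ j w) v₁) φ)) m
    ≡⟨ conv-cong m (λ j i → eval-cong (Φ i v) (λ v₁ → eval-right (Φ j w) v₁ φ)) ⟩
  conv (λ j i → eval (Φ i v) (λ v₁ → eval (Φ j w) (λ v₂ → φ (v₁ ++ v₂)))) m ∎
  where open ≡-Reasoning

eval-Φ-zero : ∀ w φ → eval (Φ 0 w) φ ≡ φ w
eval-Φ-zero w φ = trans (cong (λ p → eval p φ) (wordMap-[] w)) (eval-η w φ)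

-- Products with a ladder act by composition.

letterMap-ladder-++ : ∀ m g u φ →
  eval (letterMap (ladder m ++ g) u) φ ≡ eval (letterMap g u) (λ v → eval (Φ m v) φ)
letterMap-ladder-++ zero    g       u φ = sym (eval-cong (letterMap g u) (λ v → eval-Φ-zero v φ))
letterMap-ladder-++ (suc m) []      u φ = sym (trans (eval-η [ u ] _)
  (cong (λ p → eval p φ) (wordMap-letter (ladder (suc m)) u)))
letterMap-ladder-++ (suc m) (t ∷ g) u φ =
  trans (cong (λ p → eval p φ) (letterMap-product (B₊ (ladder m)) t g u))
    (eval-lin (Φ (suc m)) (letterMap (t ∷ g) u) φ)

-- On letters composition is the product rule. On words, Δ(λₘ g) = Δ(λₘ) Δ(g) distributes both
-- factors over w and u, and multiplicativity of Φ recombines the ladder pieces. The functional and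
-- the forest `g` stay arbitrary so that the induction hypothesis applies to every term of the
-- coproduct.
wordMap-ladder-++ : ∀ w m g φ →
  eval (wordMap (ladder m ++ g) w) φ ≡ eval (wordMap g w) (λ v → eval (Φ m v) φ)
wordMap-ladder-++ w = go (reverseView w)
  where
  go : ∀ {w} → Reverse w → ∀ m g φ →
    eval (wordMap (ladder m ++ g) w) φ ≡ eval (wordMap g w) (λ v → eval (Φ m v) φ)
  go {w} r zero    g       φ = sym (eval-cong (wordMap g w) (λ v → eval-Φ-zero v φ))
  go []  (suc m) []      φ = sym (eval-η [] _)
  go []  (suc m) (_ ∷ _) φ = trans (eval-[] φ) (sym (eval-[] _))
  go (w ∶ r ∶ʳ u) m@(suc _) g φ = begin
    eval (wordMap (ladder m ++ g) (w ∷ʳ u)) φ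
      ≡⟨ eval-wordMap-∷ʳ (ladder m ++ g) w u φ ⟩
    eval (Δ (ladder m ++ g)) _
      ≡⟨ eval-Δ-ladder-++ m g _ ⟩
    conv (λ j i → eval (Δ g) (λ (h₁ , h₂) →
      eval (wordMap (ladder i ++ h₁) w) (λ v₁ → eval (letterMap (ladder j ++ h₂) u) (λ v₂ → φ (v₁ ++ v₂))))) m
      ≡⟨ conv-cong m (λ j i → eval-cong (Δ g) λ (h₁ , h₂) → trans (go r i h₁ _)
           (eval-cong (wordMap h₁ w) λ a → trans
             (eval-cong (Φ i a) λ v₁ → letterMap-ladder-++ j h₂ u (λ v₂ → φ (v₁ ++ v₂)))
             (eval-swap (Φ i a) (letterMap h₂ u) _))) ⟩
    conv (λ j i → eval (Δ g) (λ (h₁ , h₂) → eval (wordMap h₁ w) (λ a → eval (letterMap h₂ u) (term a j i)))) m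
      -- The sum over pieces of λₘ is moved inside the action of `g`; for fixed results `a` and `b`
      -- it is then Φₘ(ab) by `eval-Φ-++`.
      ≡⟨ eval-conv (Δ g) (λ (h₁ , h₂) j i → eval (wordMap h₁ w) (λ a → eval (letterMap h₂ u) (term a j i))) m ⟨
    eval (Δ g) (λ (h₁ , h₂) → conv (λ j i → eval (wordMap h₁ w) (λ a → eval (letterMap h₂ u) (term a j i))) m)
      ≡⟨ eval-cong (Δ g) (λ (h₁ , h₂) → trans
           (sym (eval-conv (wordMap h₁ w) (λ a j i → eval (letterMap h₂ u) (term a j i)) m))
           (eval-cong (wordMap h₁ w) λ a → trans
             (sym (eval-conv (letterMap h₂ u) (λ b j i → term a j i b) m))
             (eval-cong (letterMap h₂ u) λ b → sym (eval-Φ-++ m a b φ)))) ⟩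
    eval (Δ g) (λ (h₁ , h₂) → eval (wordMap h₁ w) (λ a → eval (letterMap h₂ u) (λ b → eval (Φ m (a ++ b)) φ)))
      ≡⟨ eval-wordMap-∷ʳ g w u _ ⟨
    eval (wordMap g (w ∷ʳ u)) (λ v → eval (Φ m v) φ) ∎
    where
    open ≡-Reasoning
    term : Word → ℕ → ℕ → Word → ℚ
    term a j i b = eval (Φ i a) (λ v₁ → eval (Φ j b) (λ v₂ → φ (v₁ ++ v₂)))

-- Uniqueness of twisted derivations.

𝐱 𝐲 𝐳 𝐪 : Endo
𝐱 = right ⟨ x ⟩
𝐲 = right ⟨ y ⟩
𝐳 = 𝐱 E.+ 𝐲
𝐪 = 𝐳 E.+ 𝐲

-- The rule at x and the commutation with z = x + y fix the values at wx and wy in terms of those at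
-- w, so the value at the empty word determines everything.
twisted-unique : ∀ {F G X C : ℕ → Endo} →
  F S.* (xˢ S.+ yˢ) S.≈ (xˢ S.+ yˢ) S.* F → F S.* xˢ S.≈ X S.* F S.+ C →
  G S.* (xˢ S.+ yˢ) S.≈ (xˢ S.+ yˢ) S.* G → G S.* xˢ S.≈ X S.* G S.+ C →
  (∀ n φ → eval (F n []) φ ≡ eval (G n []) φ) → F S.≈ G
twisted-unique {F} {G} {X} {C} Fz Fx Gz Gx base =
  coefficientwise λ n → wordwise λ w φ → go (reverseView w) n φ
  where
  open ≡-Reasoning
  z : ℕ → Endo
  z = xˢ S.+ yˢ

  -- In a product the right factor acts first, so agreement at the single word `w` is enough.
  ⋆-local : ∀ H {w} → (∀ n φ → eval (F n w) φ ≡ eval (G n w) φ) →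
            ∀ n φ → eval ((H S.* F) n w) φ ≡ eval ((H S.* G) n w) φ
  ⋆-local H {w} e n φ = trans (eval-⋆ H F n w φ)
    (trans (conv-cong n (λ i j → e j _)) (sym (eval-⋆ H G n w φ)))

  go : ∀ {w} → Reverse w → ∀ n φ → eval (F n w) φ ≡ eval (G n w) φ

  go-x : ∀ {w} → Reverse w → ∀ n φ → eval ((F S.* xˢ) n w) φ ≡ eval ((G S.* xˢ) n w) φ
  go-x {w} r n φ = begin
    eval ((F S.* xˢ) n w) φ                      ≡⟨ on (at Fx n) w φ ⟩
    eval ((X S.* F S.+ C) n w) φ                     ≡⟨ eval-++ ((X S.* F) n w) (C n w) φ ⟩
    eval ((X S.* F) n w) φ ℚ.+ eval (C n w) φ        ≡⟨ cong (ℚ._+ eval (C n w) φ) (⋆-local X (go r) n φ) ⟩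
    eval ((X S.* G) n w) φ ℚ.+ eval (C n w) φ        ≡⟨ eval-++ ((X S.* G) n w) (C n w) φ ⟨
    eval ((X S.* G S.+ C) n w) φ                     ≡⟨ on (at Gx n) w φ ⟨
    eval ((G S.* xˢ) n w) φ                      ∎

  split : ∀ H n w φ → eval ((H S.* z) n w) φ ≡
    eval ((H S.* xˢ) n w) φ ℚ.+ eval ((H S.* yˢ) n w) φ
  split H n w φ = trans (on (at (S.distribˡ H xˢ yˢ) n) w φ)
    (eval-++ ((H S.* xˢ) n w) ((H S.* yˢ) n w) φ)

  go []            n φ = base n φ
  go (w ∶ r ∶ʳ x) n φ = trans (sym (⋆letter F x n w φ)) (trans (go-x r n φ) (⋆letter G x n w φ))
  -- As y = z - x, the value at wx is cancelled from the value at wz.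
  go (w ∶ r ∶ʳ y) n φ = trans (sym (⋆letter F y n w φ)) (trans
    (+-cancelˡ (eval ((F S.* xˢ) n w) φ) _ _ (begin
      eval ((F S.* xˢ) n w) φ ℚ.+ eval ((F S.* yˢ) n w) φ    ≡⟨ split F n w φ ⟨
      eval ((F S.* z) n w) φ                                        ≡⟨ on (at Fz n) w φ ⟩
      eval ((z S.* F) n w) φ                                        ≡⟨ ⋆-local z (go r) n φ ⟩
      eval ((z S.* G) n w) φ                                        ≡⟨ on (at Gz n) w φ ⟨
      eval ((G S.* z) n w) φ                                        ≡⟨ split G n w φ ⟩
      eval ((G S.* xˢ) n w) φ ℚ.+ eval ((G S.* yˢ) n w) φ
        ≡⟨ cong (ℚ._+ eval ((G S.* yˢ) n w) φ) (go-x r n φ) ⟨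
      eval ((F S.* xˢ) n w) φ ℚ.+ eval ((G S.* yˢ) n w) φ    ∎))
    (⋆letter G y n w φ))

-- The action of ladder trees on letters

q̂ : 𝔥
q̂ = ⟨ x ⟩ +ᴹ (+ 2 / 1) *ₗ ⟨ y ⟩

right-q̂ : right q̂ E.≈ 𝐪
right-q̂ = wordwise λ w φ → begin
  eval (right q̂ w) φ
    ≡⟨ eval-right q̂ w φ ⟩
  eval q̂ (λ v → φ (w ++ v))
    ≡⟨ eval-++ ⟨ x ⟩ ((+ 2 / 1) *ₗ ⟨ y ⟩) _ ⟩
  eval ⟨ x ⟩ (λ v → φ (w ++ v)) ℚ.+ eval ((+ 2 / 1) *ₗ ⟨ y ⟩) (λ v → φ (w ++ v))
    ≡⟨ cong₂ ℚ._+_ (sym (eval-right ⟨ x ⟩ w φ))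
         (trans (eval-*ₗ (+ 2 / 1) ⟨ y ⟩ _)
           (trans (cong ((1ℚ ℚ.+ 1ℚ) ℚ.*_) (sym (eval-right ⟨ y ⟩ w φ))) (double (eval (𝐲 w) φ)))) ⟩
  eval (𝐱 w) φ ℚ.+ (eval (𝐲 w) φ ℚ.+ eval (𝐲 w) φ)
    ≡⟨ ℚ.+-assoc (eval (𝐱 w) φ) _ _ ⟨
  eval (𝐱 w) φ ℚ.+ eval (𝐲 w) φ ℚ.+ eval (𝐲 w) φ
    ≡⟨ cong (ℚ._+ eval (𝐲 w) φ) (eval-++ (𝐱 w) (𝐲 w) φ) ⟨
  eval (𝐳 w) φ ℚ.+ eval (𝐲 w) φ
    ≡⟨ eval-++ (𝐳 w) (𝐲 w) φ ⟨
  eval (𝐪 w) φ ∎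
  where
  open ≡-Reasoning
  double : ∀ a → (1ℚ ℚ.+ 1ℚ) ℚ.* a ≡ a ℚ.+ a
  double a = trans (ℚ.*-distribʳ-+ a 1ℚ 1ℚ) (cong₂ ℚ._+_ (ℚ.*-identityˡ a) (ℚ.*-identityˡ a))

strip-y-∷ʳ : ∀ v → strip-y (v ∷ʳ y) ≡ η v
-- The word is replaced by a variable with an equation, since `initLast` does not reduce on
-- `v ∷ʳ y`.
strip-y-∷ʳ v = go (v ∷ʳ y) refl
  where
  go : ∀ w → w ≡ v ∷ʳ y → strip-y w ≡ η v
  go w e with initLast w
  go _ e | []      with () ← List.++-conicalʳ v [ y ] (sym e)
  go _ e | w ∷ʳ′ x with () ← List.∷ʳ-injectiveʳ w v e
  go _ e | w ∷ʳ′ y = cong η (List.∷ʳ-injectiveˡ w v e)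

graft : 𝔥 → 𝔥
graft p = R ⟨ y ⟩ (R q̂ (R-y⁻¹ p))

-- The transpose of `graft` on functionals. It lets an induction hypothesis that holds for all
-- functionals be applied underneath `graft`.
ungraft : (Word → ℚ) → Word → ℚ
ungraft φ w = eval (strip-y w) (λ v → eval q̂ (λ s → eval ⟨ y ⟩ (λ r → φ ((v ++ s) ++ r))))

eval-graft : ∀ p φ → eval (graft p) φ ≡ eval p (ungraft φ)
eval-graft p φ = trans (eval-M⊗ (R q̂ (R-y⁻¹ p)) ⟨ y ⟩ φ)
  (trans (eval-M⊗ (R-y⁻¹ p) q̂ _) (eval-lin strip-y p _))

graft-*y : ∀ p φ → eval (graft (p * ⟨ y ⟩)) φ ≡ eval (p * q̂ * ⟨ y ⟩) φ
graft-*y p φ = begin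
  eval (graft (p * ⟨ y ⟩)) φ                                ≡⟨ eval-graft (p * ⟨ y ⟩) φ ⟩
  eval (p * ⟨ y ⟩) (ungraft φ)                              ≡⟨ eval-M⊗ p ⟨ y ⟩ _ ⟩
  eval p (λ v → eval ⟨ y ⟩ (λ u → ungraft φ (v ++ u)))      ≡⟨ eval-cong p (λ v → trans (eval-η [ y ] _)
    (trans (cong (λ q → eval q (K φ)) (strip-y-∷ʳ v)) (eval-η v (K φ)))) ⟩
  eval p (K φ)                                              ≡⟨ sym (eval-M⊗ p q̂ _) ⟩
  eval (p * q̂) (λ v → eval ⟨ y ⟩ (λ r → φ (v ++ r)))        ≡⟨ sym (eval-M⊗ (p * q̂) ⟨ y ⟩ φ) ⟩
  eval (p * q̂ * ⟨ y ⟩) φ                                    ∎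
  where
  open ≡-Reasoning
  K : (Word → ℚ) → Word → ℚ
  K φ v = eval q̂ (λ s → eval ⟨ y ⟩ (λ r → φ ((v ++ s) ++ r)))

xq̂^ : ℕ → 𝔥
xq̂^ zero    = ⟨ x ⟩
xq̂^ (suc m) = xq̂^ m * q̂

-- Each further vertex of the ladder inserts a factor x + 2y before the final y.
letterMap-ladder-x : ∀ m φ → eval (letterMap (ladder (suc m)) x) φ ≡ eval (xq̂^ m * ⟨ y ⟩) φ
letterMap-ladder-x zero    φ = refl
letterMap-ladder-x (suc m) φ = begin
  eval (letterMap (ladder (suc (suc m))) x) φ           ≡⟨ cong (λ p → eval p φ) (letterMap-tree (B₊ (ladder m)) [] x) ⟩
  eval (graft (letterMap (ladder (suc m)) x)) φ         ≡⟨ eval-graft (letterMap (ladder (suc m)) x) φ ⟩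
  eval (letterMap (ladder (suc m)) x) (ungraft φ)       ≡⟨ letterMap-ladder-x m (ungraft φ) ⟩
  eval (xq̂^ m * ⟨ y ⟩) (ungraft φ)                      ≡⟨ eval-graft (xq̂^ m * ⟨ y ⟩) φ ⟨
  eval (graft (xq̂^ m * ⟨ y ⟩)) φ                        ≡⟨ graft-*y (xq̂^ m) φ ⟩
  eval (xq̂^ (suc m) * ⟨ y ⟩) φ                          ∎
  where open ≡-Reasoning

-- The one-vertex tree has opposite values on x and y, and `graft` is linear. Hence every nonempty
-- ladder kills x + y, which gives Φ(z) = z.
letterMap-ladder-y : ∀ m φ →
  eval (letterMap (ladder (suc m)) y) φ ≡ (ℚ.- 1ℚ) ℚ.* eval (letterMap (ladder (suc m)) x) φ
letterMap-ladder-y zero    φ = eval-*ₗ (ℚ.- 1ℚ) (⟨ x ⟩ * ⟨ y ⟩) φ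
letterMap-ladder-y (suc m) φ = begin
  eval (letterMap (ladder (suc (suc m))) y) φ
    ≡⟨ cong (λ p → eval p φ) (letterMap-tree (B₊ (ladder m)) [] y) ⟩
  eval (graft (letterMap (ladder (suc m)) y)) φ
    ≡⟨ eval-graft (letterMap (ladder (suc m)) y) φ ⟩
  eval (letterMap (ladder (suc m)) y) (ungraft φ)
    ≡⟨ letterMap-ladder-y m (ungraft φ) ⟩
  (ℚ.- 1ℚ) ℚ.* eval (letterMap (ladder (suc m)) x) (ungraft φ)
    ≡⟨ cong ((ℚ.- 1ℚ) ℚ.*_) (eval-graft (letterMap (ladder (suc m)) x) φ) ⟨
  (ℚ.- 1ℚ) ℚ.* eval (graft (letterMap (ladder (suc m)) x)) φ
    ≡⟨ cong (λ p → (ℚ.- 1ℚ) ℚ.* eval p φ) (letterMap-tree (B₊ (ladder m)) [] x) ⟨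
  (ℚ.- 1ℚ) ℚ.* eval (letterMap (ladder (suc (suc m))) x) φ ∎
  where open ≡-Reasoning

opposite⇒+≈0 : ∀ {p q} → (∀ φ → eval q φ ≡ (ℚ.- 1ℚ) ℚ.* eval p φ) → right p E.+ right q E.≈ E.0#
opposite⇒+≈0 {p} {q} e = E.trans (E.+-congˡ (wordwise λ w φ → trans (eval-right q w φ) (trans (e _)
    (sym (trans (eval-*ₗ (ℚ.- 1ℚ) (right p w) φ) (cong ((ℚ.- 1ℚ) ℚ.*_) (eval-right p w φ)))))))
  (E.-‿inverseʳ (right p))

right-ladder-x : ∀ m → right (letterMap (ladder (suc m)) x) E.≈ 𝐲 E.* 𝐪 ^ᴱ m E.* 𝐱
right-ladder-x m = begin
  right (letterMap (ladder (suc m)) x)    ≈⟨ (wordwise λ w φ → trans (eval-right (letterMap (ladder (suc m)) x) w φ)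
    (trans (letterMap-ladder-x m _) (sym (eval-right (xq̂^ m * ⟨ y ⟩) w φ)))) ⟩
  right (xq̂^ m * ⟨ y ⟩)                   ≈⟨ right-* (xq̂^ m) ⟨ y ⟩ ⟩
  𝐲 E.* right (xq̂^ m)                     ≈⟨ E.*-congˡ (right-xq̂^ m) ⟩
  𝐲 E.* (𝐪 ^ᴱ m E.* 𝐱)                    ≈⟨ E.*-assoc 𝐲 (𝐪 ^ᴱ m) 𝐱 ⟨
  𝐲 E.* 𝐪 ^ᴱ m E.* 𝐱                      ∎
  where
  open import Relation.Binary.Reasoning.Setoid E.setoid
  right-xq̂^ : ∀ m → right (xq̂^ m) E.≈ 𝐪 ^ᴱ m E.* 𝐱
  right-xq̂^ zero    = E.sym (E.*-identityˡ 𝐱)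
  right-xq̂^ (suc m) = begin
    right (xq̂^ m * q̂)             ≈⟨ right-* (xq̂^ m) q̂ ⟩
    right q̂ E.* right (xq̂^ m)     ≈⟨ E.*-cong right-q̂ (right-xq̂^ m) ⟩
    𝐪 E.* (𝐪 ^ᴱ m E.* 𝐱)          ≈⟨ E.*-assoc 𝐪 (𝐪 ^ᴱ m) 𝐱 ⟨
    𝐪 ^ᴱ suc m E.* 𝐱              ∎

-- Derivations

-- `∂-word` recurses on the first letter, whereas the twisted rules split off the last one; the
-- Leibniz rule for concatenations connects the two.
∂-word-++ : ∀ n v w φ → eval (∂-word n (v ++ w)) φ ≡
  eval (∂-word n v) (λ a → φ (a ++ w)) ℚ.+ eval (∂-word n w) (λ b → φ (v ++ b))
∂-word-++ n []      w φ = sym (trans (cong (ℚ._+ eval (∂-word n w) φ) (eval-[] _)) (ℚ.+-identityˡ _))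
∂-word-++ n (u ∷ v) w φ = begin
  eval (∂-word n (u ∷ v ++ w)) φ
    ≡⟨ ∂-∷ (v ++ w) φ ⟩
  eval (∂-letter n u) (λ a → φ (a ++ (v ++ w))) ℚ.+ eval (∂-word n (v ++ w)) (λ b → φ (u ∷ b))
    ≡⟨ cong₂ ℚ._+_ (eval-cong (∂-letter n u) (λ a → cong φ (sym (List.++-assoc a v w)))) (∂-word-++ n v w _) ⟩
  eval (∂-letter n u) (λ a → φ ((a ++ v) ++ w)) ℚ.+
    (eval (∂-word n v) (λ a → φ (u ∷ a ++ w)) ℚ.+ eval (∂-word n w) (λ b → φ (u ∷ v ++ b)))
    ≡⟨ ℚ.+-assoc (eval (∂-letter n u) _) (eval (∂-word n v) _) (eval (∂-word n w) _) ⟨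
  eval (∂-letter n u) (λ a → φ ((a ++ v) ++ w)) ℚ.+
    eval (∂-word n v) (λ a → φ (u ∷ a ++ w)) ℚ.+ eval (∂-word n w) (λ b → φ (u ∷ v ++ b))
    ≡⟨ cong (ℚ._+ eval (∂-word n w) (λ b → φ (u ∷ v ++ b))) (∂-∷ v (λ a → φ (a ++ w))) ⟨
  eval (∂-word n (u ∷ v)) (λ a → φ (a ++ w)) ℚ.+ eval (∂-word n w) (λ b → φ (u ∷ v ++ b)) ∎
  where
  open ≡-Reasoning
  ∂-∷ : ∀ v φ → eval (∂-word n (u ∷ v)) φ ≡
    eval (∂-letter n u) (λ a → φ (a ++ v)) ℚ.+ eval (∂-word n v) (λ b → φ (u ∷ b))
  ∂-∷ v φ = trans (eval-++ (∂-letter n u * η v) (⟨ u ⟩ * ∂-word n v) φ) (cong₂ ℚ._+_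
    (trans (eval-M⊗ (∂-letter n u) (η v) φ) (eval-cong (∂-letter n u) (λ a → eval-η v _)))
    (trans (eval-M⊗ ⟨ u ⟩ (∂-word n v) φ) (eval-η [ u ] _)))

∂-letterʳ : ∀ n u → ∂-word n E.* right ⟨ u ⟩ E.≈ right ⟨ u ⟩ E.* ∂-word n E.+ right (∂-letter n u)
∂-letterʳ n u = wordwise λ w φ → begin
  eval ((∂-word n E.* right ⟨ u ⟩) w) φ
    ≡⟨ eval-∘ (∂-word n) (right ⟨ u ⟩) w φ ⟩
  eval (right ⟨ u ⟩ w) (λ v → eval (∂-word n v) φ)
    ≡⟨ trans (eval-right ⟨ u ⟩ w _) (eval-η [ u ] _) ⟩
  eval (∂-word n (w ∷ʳ u)) φ
    ≡⟨ ∂-word-++ n w [ u ] φ ⟩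
  eval (∂-word n w) (λ a → φ (a ++ [ u ])) ℚ.+ eval (∂-word n [ u ]) (λ b → φ (w ++ b))
    ≡⟨ cong₂ ℚ._+_
         (eval-cong (∂-word n w) (λ a → sym (trans (eval-right ⟨ u ⟩ a φ) (eval-η [ u ] _))))
         (trans (∂-[u] _) (sym (eval-right (∂-letter n u) w φ))) ⟩
  eval (∂-word n w) (λ a → eval (right ⟨ u ⟩ a) φ) ℚ.+ eval (right (∂-letter n u) w) φ
    ≡⟨ cong (ℚ._+ eval (right (∂-letter n u) w) φ) (eval-∘ (right ⟨ u ⟩) (∂-word n) w φ) ⟨
  eval ((right ⟨ u ⟩ E.* ∂-word n) w) φ ℚ.+ eval (right (∂-letter n u) w) φ
    ≡⟨ eval-++ ((right ⟨ u ⟩ E.* ∂-word n) w) (right (∂-letter n u) w) φ ⟨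
  eval ((right ⟨ u ⟩ E.* ∂-word n E.+ right (∂-letter n u)) w) φ ∎
  where
  open ≡-Reasoning
  ∂-[u] : ∀ φ → eval (∂-word n [ u ]) φ ≡ eval (∂-letter n u) φ
  ∂-[u] φ = trans (eval-++ (∂-letter n u * η []) (⟨ u ⟩ * 0ᴹ) φ) (trans (cong₂ ℚ._+_
    (trans (eval-M⊗ (∂-letter n u) (η []) φ) (eval-cong (∂-letter n u) (λ a →
      trans (eval-η [] _) (cong φ (List.++-identityʳ a)))))
    (trans (eval-M⊗ ⟨ u ⟩ 0ᴹ φ) (trans (eval-cong ⟨ u ⟩ (λ _ → eval-[] _)) (eval-0 ⟨ u ⟩))))
    (ℚ.+-identityʳ _))

^-commute : ∀ {a b} → a E.* b E.≈ b E.* a → ∀ m → a E.* b ^ᴱ m E.≈ b ^ᴱ m E.* a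
^-commute {a} {b} e zero    = E.trans (E.*-identityʳ a) (E.sym (E.*-identityˡ a))
^-commute {a} {b} e (suc m) = begin
  a E.* (b E.* b ^ᴱ m)    ≈⟨ E.*-assoc a b _ ⟨
  a E.* b E.* b ^ᴱ m      ≈⟨ E.*-congʳ e ⟩
  b E.* a E.* b ^ᴱ m      ≈⟨ E.*-assoc b a _ ⟩
  b E.* (a E.* b ^ᴱ m)    ≈⟨ E.*-congˡ (^-commute e m) ⟩
  b E.* (b ^ᴱ m E.* a)    ≈⟨ E.*-assoc b _ a ⟨
  b ^ᴱ suc m E.* a        ∎
  where open import Relation.Binary.Reasoning.Setoid E.setoid

right-∂-letter : ∀ m → right (∂-letter (suc m) x) E.≈ 𝐲 E.* 𝐳 ^ᴱ m E.* 𝐱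
right-∂-letter m = begin
  right (⟨ x ⟩ * ẑ ^ m * ⟨ y ⟩)           ≈⟨ right-* (⟨ x ⟩ * ẑ ^ m) ⟨ y ⟩ ⟩
  𝐲 E.* right (⟨ x ⟩ * ẑ ^ m)             ≈⟨ E.*-congˡ (right-* ⟨ x ⟩ (ẑ ^ m)) ⟩
  𝐲 E.* (right (ẑ ^ m) E.* 𝐱)             ≈⟨ E.*-congˡ (E.*-congʳ (right-^ m)) ⟩
  𝐲 E.* (𝐳 ^ᴱ m E.* 𝐱)                    ≈⟨ E.*-assoc 𝐲 (𝐳 ^ᴱ m) 𝐱 ⟨
  𝐲 E.* 𝐳 ^ᴱ m E.* 𝐱                      ∎
  where
  open import Relation.Binary.Reasoning.Setoid E.setoid
  ẑ : 𝔥
  ẑ = ⟨ x ⟩ +ᴹ ⟨ y ⟩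

  right-ẑ : right ẑ E.≈ 𝐳
  right-ẑ = wordwise λ w φ → trans (eval-right ẑ w φ) (trans (eval-++ ⟨ x ⟩ ⟨ y ⟩ _)
    (sym (trans (eval-++ (𝐱 w) (𝐲 w) φ) (cong₂ ℚ._+_ (eval-right ⟨ x ⟩ w φ) (eval-right ⟨ y ⟩ w φ)))))

  right-^ : ∀ m → right (ẑ ^ m) E.≈ 𝐳 ^ᴱ m
  right-^ zero    = right-1
  right-^ (suc m) = begin
    right (ẑ * ẑ ^ m)              ≈⟨ right-* ẑ (ẑ ^ m) ⟩
    right (ẑ ^ m) E.* right ẑ      ≈⟨ E.*-cong (right-^ m) right-ẑ ⟩
    𝐳 ^ᴱ m E.* 𝐳                   ≈⟨ ^-commute E.refl m ⟨
    𝐳 ^ᴱ suc m                     ∎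

-- The generating series θ and Φ

2^_∸1 : ℕ → ℕ
2^ n ∸1 = 2 ℕ.^ n ∸ 1

2^suc∸1 : ∀ n → 2^ suc n ∸1 ≡ suc (2^ n ∸1 ℕ.+ 2^ n ∸1)
2^suc∸1 n = aux (2 ℕ.^ n) (ℕ.m^n>0 2 n)
  where
  aux : ∀ m → 0 < m → 2 ℕ.* m ∸ 1 ≡ suc (m ∸ 1 ℕ.+ (m ∸ 1))
  aux (suc m) _ = trans (cong (m ℕ.+_) (ℕ.+-identityʳ (suc m))) (ℕ.+-suc m m)

-- `G` is (1 - tz)⁻¹. The coefficients of `Z` come from partial fractions: tz (1 - 2tz)⁻¹ (1 - tz)⁻¹
-- = (1 - 2tz)⁻¹ - (1 - tz)⁻¹.
B G Z θ : ℕ → Endo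
B n = 𝐪 ^ᴱ n
G n = 𝐳 ^ᴱ n
Z zero    = E.0#
Z (suc n) = 2^ suc n ∸1 ×ᴱ 𝐳 ^ᴱ n
θ n = 2^ n ∸1 ×ᴱ ∂-word n

open TwistedDerivations (PowerSeries.ring endoRing) using (1-*ˡ; 1-*ʳ; module Generators)
module Gen = Generators xˢ yˢ t B Z t-central
open Gen using (z; P; X; W; a; b)

-- The geometric series and their inverses.

const-z : const 𝐳 S.≈ z
const-z = const-+ 𝐱 𝐲

const-q : const 𝐪 S.≈ z S.+ yˢ
const-q = S.trans (const-+ 𝐳 𝐲) (S.+-congʳ const-z)

^-recurrenceˡ : ∀ c → (c ^ᴱ_) S.≈ S.1# S.+ t S.* const c S.* (c ^ᴱ_)
^-recurrenceˡ c = recurrenceˡ E.refl (λ n → E.sym (E.+-identityˡ _))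

^-recurrenceʳ : ∀ c → (c ^ᴱ_) S.≈ S.1# S.+ (c ^ᴱ_) S.* (t S.* const c)
^-recurrenceʳ c = recurrenceʳ E.refl
  (λ n → E.trans (^-commute E.refl n) (E.sym (E.+-identityˡ _)))

B≈1+[z+y]P : B S.≈ S.1# S.+ (z S.+ yˢ) S.* P
B≈1+[z+y]P = S.trans (^-recurrenceˡ 𝐪) (S.+-congˡ (S.trans (Gen.tuB≈uP (const 𝐪)) (S.*-congʳ const-q)))

B≈1+P[z+y] : B S.≈ S.1# S.+ P S.* (z S.+ yˢ)
B≈1+P[z+y] = S.trans (^-recurrenceʳ 𝐪) (S.+-congˡ (S.trans (Gen.B*tu≈Pu (const 𝐪)) (S.*-congˡ const-q)))

aG≈1 : a S.* G S.≈ S.1#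
aG≈1 = 1-*ˡ (S.trans (^-recurrenceˡ 𝐳) (S.+-congˡ (S.*-congʳ (S.*-congˡ const-z))))

Ga≈1 : G S.* a S.≈ S.1#
Ga≈1 = 1-*ʳ (S.trans (^-recurrenceʳ 𝐳) (S.+-congˡ (S.*-congˡ (S.*-congˡ const-z))))

Z-commute : ∀ {c} → c E.* 𝐳 E.≈ 𝐳 E.* c → ∀ n → c E.* Z n E.≈ Z n E.* c
Z-commute {c} e zero    = E.trans (E.zeroʳ c) (E.sym (E.zeroˡ c))
Z-commute {c} e (suc n) = E.trans (×ᴱ-comm-* 2^ suc n ∸1 c _)
  (E.trans (×ᴱ-congʳ 2^ suc n ∸1 (^-commute e n)) (E.sym (×ᴱ-assoc-* 2^ suc n ∸1 _ c)))

-- The coefficient form of (1 - 2tz) Z = t G; arithmetically, 2ⁿ⁺¹ - 1 = 1 + 2 (2ⁿ - 1).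
Z-suc : ∀ n → Z (suc n) E.≈ G n E.+ (𝐳 E.+ 𝐳) E.* Z n
Z-suc zero    = E.+-congˡ (E.sym (E.zeroʳ _))
Z-suc (suc n) = begin
  2^ suc (suc n) ∸1 ×ᴱ 𝐳 ^ᴱ suc n                              ≈⟨ ×ᴱ-congˡ (2^suc∸1 (suc n)) ⟩
  𝐳 ^ᴱ suc n E.+ (c ℕ.+ c) ×ᴱ 𝐳 ^ᴱ suc n                       ≈⟨ E.+-congˡ (×ᴱ-homo-+ _ c c) ⟩
  𝐳 ^ᴱ suc n E.+ (c ×ᴱ 𝐳 ^ᴱ suc n E.+ c ×ᴱ 𝐳 ^ᴱ suc n)
    ≈⟨ E.+-congˡ {𝐳 ^ᴱ suc n} (E.+-cong (×ᴱ-comm-* c 𝐳 (𝐳 ^ᴱ n)) (×ᴱ-comm-* c 𝐳 (𝐳 ^ᴱ n))) ⟨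
  𝐳 ^ᴱ suc n E.+ (𝐳 E.* Z (suc n) E.+ 𝐳 E.* Z (suc n))         ≈⟨ E.+-congˡ (E.distribʳ _ 𝐳 𝐳) ⟨
  𝐳 ^ᴱ suc n E.+ (𝐳 E.+ 𝐳) E.* Z (suc n)                       ∎
  where
  open import Relation.Binary.Reasoning.Setoid E.setoid
  c : ℕ
  c = 2^ suc n ∸1

const-z+z : const (𝐳 E.+ 𝐳) S.≈ z S.+ z
const-z+z = S.trans (const-+ 𝐳 𝐳) (S.+-cong const-z const-z)

shift≈t* : ∀ f → shift f S.≈ t S.* f
shift≈t* f = S.sym (coefficientwise (t⋆ f))

bZ≈tG : b S.* Z S.≈ t S.* G
bZ≈tG = 1-*ˡ (S.trans (recurrenceˡ {𝐳 E.+ 𝐳} {Z} {shift G} E.refl Z-suc)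
  (S.+-cong (shift≈t* G) (S.*-congʳ (S.*-congˡ const-z+z))))

Zb≈tG : Z S.* b S.≈ t S.* G
Zb≈tG = 1-*ʳ (S.trans (recurrenceʳ {𝐳 E.+ 𝐳} {Z} {shift G} E.refl
    (λ n → E.trans (Z-suc n) (E.+-congˡ (Z-commute (E.trans (E.distribʳ 𝐳 𝐳 𝐳) (E.sym (E.distribˡ 𝐳 𝐳 𝐳))) n))))
  (S.+-cong (shift≈t* G) (S.*-congˡ (S.*-congˡ const-z+z))))

bZa≈t : b S.* Z S.* a S.≈ t
bZa≈t = begin
  b S.* Z S.* a      ≈⟨ S.*-congʳ bZ≈tG ⟩
  t S.* G S.* a      ≈⟨ S.*-assoc t G a ⟩
  t S.* (G S.* a)    ≈⟨ S.*-congˡ Ga≈1 ⟩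
  t S.* S.1#         ≈⟨ S.*-identityʳ t ⟩
  t                  ∎
  where open import Relation.Binary.Reasoning.Setoid S.setoid

aZb≈t : a S.* Z S.* b S.≈ t
aZb≈t = begin
  a S.* Z S.* b      ≈⟨ S.*-assoc a Z b ⟩
  a S.* (Z S.* b)    ≈⟨ S.*-congˡ Zb≈tG ⟩
  a S.* (t S.* G)    ≈⟨ S.*-assoc a t G ⟨
  a S.* t S.* G      ≈⟨ S.*-congʳ (t-central a) ⟨
  t S.* a S.* G      ≈⟨ S.*-assoc t a G ⟩
  t S.* (a S.* G)    ≈⟨ S.*-congˡ aG≈1 ⟩
  t S.* S.1#         ≈⟨ S.*-identityʳ t ⟩
  t                  ∎
  where open import Relation.Binary.Reasoning.Setoid S.setoid

-- Commutation of Φ and θ with x and z.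

sandwich : ∀ c F d n → (const c S.* F S.* const d) n E.≈ c E.* F n E.* d
sandwich c F d n = E.trans (⋆const d (const c S.* F) n) (E.*-congʳ (const⋆ c F n))

letterSeries-x : letterSeries x S.≈ X
letterSeries-x = coefficientwise λ
  { zero    → E.sym (E.trans (E.+-congˡ (E.trans (yPx 0) (E.trans (E.*-congʳ (E.zeroʳ 𝐲)) (E.zeroˡ 𝐱))))
                             (E.+-identityʳ 𝐱))
  ; (suc m) → E.trans (right-ladder-x m) (E.sym (E.trans (E.+-identityˡ _) (yPx (suc m))))
  }
  where
  yPx : ∀ n → (yˢ S.* P S.* xˢ) n E.≈ 𝐲 E.* shift B n E.* 𝐱
  yPx n = E.trans (sandwich 𝐲 P 𝐱 n) (E.*-congʳ (E.*-congˡ (t⋆ B n)))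

Φx≈XΦ : Φ S.* xˢ S.≈ X S.* Φ
Φx≈XΦ = S.trans (Φ-letter x) (S.*-congʳ letterSeries-x)

Φz≈zΦ : Φ S.* z S.≈ z S.* Φ
Φz≈zΦ = begin
  Φ S.* (xˢ S.+ yˢ)                               ≈⟨ S.distribˡ Φ xˢ yˢ ⟩
  Φ S.* xˢ S.+ Φ S.* yˢ                           ≈⟨ S.+-cong (Φ-letter x) (Φ-letter y) ⟩
  letterSeries x S.* Φ S.+ letterSeries y S.* Φ           ≈⟨ S.sym (S.distribʳ Φ (letterSeries x) (letterSeries y)) ⟩
  (letterSeries x S.+ letterSeries y) S.* Φ               ≈⟨ S.*-congʳ sum ⟩
  z S.* Φ                                                 ∎
  where
  open import Relation.Binary.Reasoning.Setoid S.setoid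
  sum : letterSeries x S.+ letterSeries y S.≈ z
  sum = coefficientwise λ
    { zero    → E.refl
    ; (suc m) → E.trans (opposite⇒+≈0 (letterMap-ladder-y m)) (E.sym (E.+-identityˡ E.0#))
    }

coefficients-commute : ∀ {c} F → (∀ n → F n E.* c E.≈ c E.* F n) → F S.* const c S.≈ const c S.* F
coefficients-commute {c} F e = coefficientwise λ n →
  E.trans (⋆const c F n) (E.trans (e n) (E.sym (const⋆ c F n)))

Φ𝐳≈𝐳Φ : ∀ n → Φ n E.* 𝐳 E.≈ 𝐳 E.* Φ n
Φ𝐳≈𝐳Φ n = E.trans (E.sym (⋆const 𝐳 Φ n))
  (E.trans (at (S.trans (S.*-congˡ const-z) (S.trans Φz≈zΦ (S.*-congʳ (S.sym const-z)))) n)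
    (const⋆ 𝐳 Φ n))

ΦZ≈ZΦ : Φ S.* Z S.≈ Z S.* Φ
ΦZ≈ZΦ = ⋆-comm-coefficients (λ i j → Z-commute (Φ𝐳≈𝐳Φ i) j)

×ᴱ-commutator : ∀ k {F c d} → F E.* c E.≈ c E.* F E.+ d →
  k ×ᴱ F E.* c E.≈ c E.* k ×ᴱ F E.+ k ×ᴱ d
×ᴱ-commutator k {F} {c} {d} e = begin
  k ×ᴱ F E.* c                       ≈⟨ ×ᴱ-assoc-* k F c ⟩
  k ×ᴱ (F E.* c)                     ≈⟨ ×ᴱ-congʳ k e ⟩
  k ×ᴱ (c E.* F E.+ d)               ≈⟨ ×ᴱ-distrib-+ _ _ k ⟩
  k ×ᴱ (c E.* F) E.+ k ×ᴱ d          ≈⟨ E.+-congʳ (×ᴱ-comm-* k c F) ⟨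
  c E.* k ×ᴱ F E.+ k ×ᴱ d            ∎
  where open import Relation.Binary.Reasoning.Setoid E.setoid

θx≈xθ+yZx : θ S.* xˢ S.≈ xˢ S.* θ S.+ yˢ S.* Z S.* xˢ
θx≈xθ+yZx = coefficientwise λ n → E.trans (⋆const 𝐱 θ n)
  (E.trans (×ᴱ-commutator 2^ n ∸1 (∂-letterʳ n x))
    (E.+-cong (E.sym (const⋆ 𝐱 θ n)) (E.trans (eq n) (E.sym (sandwich 𝐲 Z 𝐱 n)))))
  where
  eq : ∀ n → 2^ n ∸1 ×ᴱ right (∂-letter n x) E.≈ 𝐲 E.* Z n E.* 𝐱
  eq zero    = E.sym (E.trans (E.*-congʳ (E.zeroʳ 𝐲)) (E.zeroˡ 𝐱))
  eq (suc n) = E.trans (×ᴱ-congʳ 2^ suc n ∸1 (right-∂-letter n))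
    (E.sym (E.trans (E.*-congʳ (×ᴱ-comm-* 2^ suc n ∸1 𝐲 _)) (×ᴱ-assoc-* 2^ suc n ∸1 _ 𝐱)))

θz≈zθ : θ S.* z S.≈ z S.* θ
θz≈zθ = S.trans (S.*-congˡ (S.sym const-z))
  (S.trans (coefficients-commute θ commute) (S.*-congʳ const-z))
  where
  open import Relation.Binary.Reasoning.Setoid E.setoid
  ∂𝐳≈𝐳∂ : ∀ n → ∂-word n E.* 𝐳 E.≈ 𝐳 E.* ∂-word n
  ∂𝐳≈𝐳∂ n = begin
    ∂-word n E.* (𝐱 E.+ 𝐲)                               ≈⟨ E.distribˡ (∂-word n) 𝐱 𝐲 ⟩
    ∂-word n E.* 𝐱 E.+ ∂-word n E.* 𝐲                    ≈⟨ E.+-cong (∂-letterʳ n x) (∂-letterʳ n y) ⟩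
    (𝐱 E.* ∂-word n E.+ right (∂-letter n x)) E.+ (𝐲 E.* ∂-word n E.+ right (∂-letter n y))
      ≈⟨ +ᴱ-interchange (𝐱 E.* ∂-word n) (right (∂-letter n x)) (𝐲 E.* ∂-word n) (right (∂-letter n y)) ⟩
    (𝐱 E.* ∂-word n E.+ 𝐲 E.* ∂-word n) E.+ (right (∂-letter n x) E.+ right (∂-letter n y))
      ≈⟨ E.+-cong (E.sym (E.distribʳ (∂-word n) 𝐱 𝐲))
           (opposite⇒+≈0 {∂-letter n x} (λ φ → eval-*ₗ (ℚ.- 1ℚ) (∂-letter n x) φ)) ⟩
    𝐳 E.* ∂-word n E.+ E.0#                              ≈⟨ E.+-identityʳ _ ⟩
    𝐳 E.* ∂-word n                                       ∎
    where
    open import Algebra.Properties.CommutativeSemigroup (CommutativeMonoid.commutativeSemigroup E.+-commutativeMonoid)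
      using () renaming (interchange to +ᴱ-interchange)

  commute : ∀ n → θ n E.* 𝐳 E.≈ 𝐳 E.* θ n
  commute n = E.trans (×ᴱ-assoc-* 2^ n ∸1 (∂-word n) 𝐳)
    (E.trans (×ᴱ-congʳ 2^ n ∸1 (∂𝐳≈𝐳∂ n)) (E.sym (×ᴱ-comm-* 2^ n ∸1 𝐳 (∂-word n))))

θX≈Xθ+W : θ S.* X S.≈ X S.* θ S.+ W
θX≈Xθ+W = Gen.θX≈Xθ+W B≈1+[z+y]P B≈1+P[z+y] bZa≈t aZb≈t θ θz≈zθ θx≈xθ+yZx

Nz≈0 : N z S.≈ S.0#
Nz≈0 = S.trans (N-cong (S.sym const-z)) (N-const 𝐳)

NX≈W : N X S.≈ W
NX≈W = Gen.NX≈W B≈1+[z+y]P B≈1+P[z+y] bZa≈t aZb≈t N N-cong N-+ N-⋆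
  (N-const E.1#) (N-const 𝐱) (N-const 𝐲) N-t

-- The common twisted Leibniz rule.

module _ where
  open import Relation.Binary.Reasoning.Setoid S.setoid

  -- The difference of the rules for z and for x, as X + Y = z.
  YΦ≈Φy : Gen.Y S.* Φ S.≈ Φ S.* yˢ
  YΦ≈Φy = +ˢ-cancelˡ (X S.* Φ) _ _ (begin
    X S.* Φ S.+ Gen.Y S.* Φ           ≈⟨ S.distribʳ Φ X Gen.Y ⟨
    (X S.+ Gen.Y) S.* Φ               ≈⟨ S.*-congʳ Gen.X+Y≈z ⟩
    z S.* Φ                           ≈⟨ Φz≈zΦ ⟨
    Φ S.* z                           ≈⟨ S.distribˡ Φ xˢ yˢ ⟩
    Φ S.* xˢ S.+ Φ S.* yˢ     ≈⟨ S.+-congʳ Φx≈XΦ ⟩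
    X S.* Φ S.+ Φ S.* yˢ          ∎)
    where open import Algebra.Properties.Group S.+-group using () renaming (∙-cancelˡ to +ˢ-cancelˡ)

  -- The same term `W` has a different origin in each of the three rules: here it is the image of
  -- xZy under Φ, where `Z` passes through as a series in z; in `θΦx≈` it is the commutator of `θ`
  -- with `X`; in `NΦx≈` it is `N X`.
  Φθx≈ : Φ S.* θ S.* xˢ S.≈ X S.* (Φ S.* θ) S.+ W S.* Φ
  Φθx≈ = begin
    Φ S.* θ S.* xˢ                                        ≈⟨ S.*-assoc Φ θ xˢ ⟩
    Φ S.* (θ S.* xˢ)                                      ≈⟨ S.*-congˡ θx≈xθ+yZx ⟩
    Φ S.* (xˢ S.* θ S.+ yˢ S.* Z S.* xˢ)          ≈⟨ S.distribˡ Φ _ _ ⟩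
    Φ S.* (xˢ S.* θ) S.+ Φ S.* (yˢ S.* Z S.* xˢ)  ≈⟨ S.+-cong first second ⟩
    X S.* (Φ S.* θ) S.+ W S.* Φ                               ∎
    where
    first : Φ S.* (xˢ S.* θ) S.≈ X S.* (Φ S.* θ)
    first = begin
      Φ S.* (xˢ S.* θ)    ≈⟨ S.sym (S.*-assoc Φ xˢ θ) ⟩
      Φ S.* xˢ S.* θ      ≈⟨ S.*-congʳ Φx≈XΦ ⟩
      X S.* Φ S.* θ           ≈⟨ S.*-assoc X Φ θ ⟩
      X S.* (Φ S.* θ)         ∎

    second : Φ S.* (yˢ S.* Z S.* xˢ) S.≈ W S.* Φ
    second = begin
      Φ S.* (yˢ S.* Z S.* xˢ)       ≈⟨ S.sym (S.*-assoc Φ (yˢ S.* Z) xˢ) ⟩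
      Φ S.* (yˢ S.* Z) S.* xˢ       ≈⟨ S.*-congʳ (S.sym (S.*-assoc Φ yˢ Z)) ⟩
      Φ S.* yˢ S.* Z S.* xˢ         ≈⟨ S.*-congʳ (S.*-congʳ (S.sym YΦ≈Φy)) ⟩
      Gen.Y S.* Φ S.* Z S.* xˢ          ≈⟨ S.*-congʳ (S.*-assoc Gen.Y Φ Z) ⟩
      Gen.Y S.* (Φ S.* Z) S.* xˢ        ≈⟨ S.*-congʳ (S.*-congˡ ΦZ≈ZΦ) ⟩
      Gen.Y S.* (Z S.* Φ) S.* xˢ        ≈⟨ S.*-congʳ (S.sym (S.*-assoc Gen.Y Z Φ)) ⟩
      Gen.Y S.* Z S.* Φ S.* xˢ          ≈⟨ S.*-assoc (Gen.Y S.* Z) Φ xˢ ⟩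
      Gen.Y S.* Z S.* (Φ S.* xˢ)        ≈⟨ S.*-congˡ Φx≈XΦ ⟩
      Gen.Y S.* Z S.* (X S.* Φ)             ≈⟨ S.sym (S.*-assoc (Gen.Y S.* Z) X Φ) ⟩
      Gen.Y S.* Z S.* X S.* Φ               ≈⟨ S.*-congʳ (Gen.YZX≈W B≈1+[z+y]P B≈1+P[z+y] bZa≈t aZb≈t) ⟩
      W S.* Φ                               ∎

  θΦx≈ : θ S.* Φ S.* xˢ S.≈ X S.* (θ S.* Φ) S.+ W S.* Φ
  θΦx≈ = begin
    θ S.* Φ S.* xˢ                ≈⟨ S.*-assoc θ Φ xˢ ⟩
    θ S.* (Φ S.* xˢ)              ≈⟨ S.*-congˡ Φx≈XΦ ⟩
    θ S.* (X S.* Φ)                   ≈⟨ S.*-assoc θ X Φ ⟨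
    θ S.* X S.* Φ                     ≈⟨ S.*-congʳ θX≈Xθ+W ⟩
    (X S.* θ S.+ W) S.* Φ             ≈⟨ S.distribʳ Φ (X S.* θ) W ⟩
    X S.* θ S.* Φ S.+ W S.* Φ         ≈⟨ S.+-congʳ (S.*-assoc X θ Φ) ⟩
    X S.* (θ S.* Φ) S.+ W S.* Φ       ∎

  *z≈z* : ∀ {F F′} → F S.* z S.≈ z S.* F → F′ S.* z S.≈ z S.* F′ → F S.* F′ S.* z S.≈ z S.* (F S.* F′)
  *z≈z* {F} {F′} e e′ = begin
    F S.* F′ S.* z        ≈⟨ S.*-assoc F F′ z ⟩
    F S.* (F′ S.* z)      ≈⟨ S.*-congˡ e′ ⟩
    F S.* (z S.* F′)      ≈⟨ S.*-assoc F z F′ ⟨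
    F S.* z S.* F′        ≈⟨ S.*-congʳ e ⟩
    z S.* F S.* F′        ≈⟨ S.*-assoc z F F′ ⟩
    z S.* (F S.* F′)      ∎

  N-*constʳ : ∀ F {c} → N c S.≈ S.0# → N (F S.* c) S.≈ N F S.* c
  N-*constʳ F {c} e = S.trans (N-⋆ F c)
    (S.trans (S.+-congˡ (S.trans (S.*-congˡ e) (S.zeroʳ F))) (S.+-identityʳ _))

  NΦx≈ : N Φ S.* xˢ S.≈ X S.* N Φ S.+ W S.* Φ
  NΦx≈ = begin
    N Φ S.* xˢ                    ≈⟨ N-*constʳ Φ (N-const 𝐱) ⟨
    N (Φ S.* xˢ)                  ≈⟨ N-cong Φx≈XΦ ⟩
    N (X S.* Φ)                       ≈⟨ N-⋆ X Φ ⟩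
    N X S.* Φ S.+ X S.* N Φ           ≈⟨ S.+-comm (N X S.* Φ) (X S.* N Φ) ⟩
    X S.* N Φ S.+ N X S.* Φ           ≈⟨ S.+-congˡ (S.*-congʳ NX≈W) ⟩
    X S.* N Φ S.+ W S.* Φ             ∎

  NΦz≈zNΦ : N Φ S.* z S.≈ z S.* N Φ
  NΦz≈zNΦ = begin
    N Φ S.* z                  ≈⟨ N-*constʳ Φ Nz≈0 ⟨
    N (Φ S.* z)                ≈⟨ N-cong Φz≈zΦ ⟩
    N (z S.* Φ)                ≈⟨ N-⋆ z Φ ⟩
    N z S.* Φ S.+ z S.* N Φ    ≈⟨ S.+-congʳ (S.trans (S.*-congʳ Nz≈0) (S.zeroˡ Φ)) ⟩
    S.0# S.+ z S.* N Φ         ≈⟨ S.+-identityˡ _ ⟩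
    z S.* N Φ                  ∎

×ᴱ-on : ∀ k F w φ → eval (F w) φ ≡ 0ℚ → eval ((k ×ᴱ F) w) φ ≡ 0ℚ
×ᴱ-on zero    F w φ e = eval-[] φ
×ᴱ-on (suc k) F w φ e = trans (eval-++ (F w) ((k ×ᴱ F) w) φ)
  (trans (cong₂ ℚ._+_ e (×ᴱ-on k F w φ e)) (ℚ.+-identityˡ 0ℚ))

θ-[] : ∀ n φ → eval (θ n []) φ ≡ 0ℚ
θ-[] n φ = ×ᴱ-on 2^ n ∸1 (∂-word n) [] φ (eval-[] φ)

NΦ-[] : ∀ n φ → eval (N Φ n []) φ ≡ 0ℚ
NΦ-[] zero    φ = eval-[] φ
NΦ-[] (suc n) φ = ×ᴱ-on (suc n) (Φ (suc n)) [] φ (eval-[] φ)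

Φθ-[] : ∀ n φ → eval ((Φ S.* θ) n []) φ ≡ 0ℚ
Φθ-[] n φ = trans (eval-⋆ Φ θ n [] φ) (trans (conv-cong n (λ i j → θ-[] j _)) (conv-ε n))

θΦ-[] : ∀ n φ → eval ((θ S.* Φ) n []) φ ≡ 0ℚ
θΦ-[] n φ = trans (eval-⋆ θ Φ n [] φ) (trans (conv-cong n zeros) (conv-ε n))
  where
  zeros : ∀ i j → eval (Φ j []) (λ v → eval (θ i v) φ) ≡ 0ℚ
  zeros i zero    = trans (eval-Φ-zero [] _) (θ-[] i φ)
  zeros i (suc j) = eval-[] _

θΦ≈Φθ : θ S.* Φ S.≈ Φ S.* θ
θΦ≈Φθ = twisted-unique (*z≈z* θz≈zθ Φz≈zΦ) θΦx≈ (*z≈z* Φz≈zΦ θz≈zθ) Φθx≈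
  (λ n φ → trans (θΦ-[] n φ) (sym (Φθ-[] n φ)))

NΦ≈θΦ : N Φ S.≈ θ S.* Φ
NΦ≈θΦ = twisted-unique NΦz≈zNΦ NΦx≈ (*z≈z* θz≈zθ Φz≈zΦ) θΦx≈
  (λ n φ → trans (NΦ-[] n φ) (sym (θΦ-[] n φ)))

-- The logarithm of Φ

Ψ : ℕ → Endo
Ψ zero    = E.0#
Ψ (suc m) = Φ (suc m)

Φ≈1+Ψ : Φ S.≈ S.1# S.+ Ψ
Φ≈1+Ψ = coefficientwise λ
  { zero    → wordwise λ w φ → trans (eval-Φ-zero w φ)
      (sym (trans (cong (λ p → eval p φ) (List.++-identityʳ (η w))) (eval-η w φ)))
  ; (suc m) → E.sym (E.+-identityˡ _)
  }

θΨ≈Ψθ : θ S.* Ψ S.≈ Ψ S.* θ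
θΨ≈Ψθ = ∙-cancelˡ θ (θ S.* Ψ) (Ψ S.* θ) (begin
  θ S.+ θ S.* Ψ                ≈⟨ S.+-congʳ (S.*-identityʳ θ) ⟨
  θ S.* S.1# S.+ θ S.* Ψ       ≈⟨ S.distribˡ θ S.1# Ψ ⟨
  θ S.* (S.1# S.+ Ψ)           ≈⟨ S.*-congˡ Φ≈1+Ψ ⟨
  θ S.* Φ                      ≈⟨ θΦ≈Φθ ⟩
  Φ S.* θ                      ≈⟨ S.*-congʳ Φ≈1+Ψ ⟩
  (S.1# S.+ Ψ) S.* θ           ≈⟨ S.distribʳ θ S.1# Ψ ⟩
  S.1# S.* θ S.+ Ψ S.* θ       ≈⟨ S.+-congʳ (S.*-identityˡ θ) ⟩
  θ S.+ Ψ S.* θ                ∎)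
  where
  open import Algebra.Properties.Group S.+-group using (∙-cancelˡ)
  open import Relation.Binary.Reasoning.Setoid S.setoid

NΨ≈θ[1+Ψ] : N Ψ S.≈ θ S.* (S.1# S.+ Ψ)
NΨ≈θ[1+Ψ] = begin
  N Ψ                      ≈⟨ S.+-identityˡ (N Ψ) ⟨
  S.0# S.+ N Ψ             ≈⟨ S.+-congʳ (N-const E.1#) ⟨
  N S.1# S.+ N Ψ           ≈⟨ N-+ S.1# Ψ ⟨
  N (S.1# S.+ Ψ)           ≈⟨ N-cong Φ≈1+Ψ ⟨
  N Φ                      ≈⟨ NΦ≈θΦ ⟩
  θ S.* Φ                  ≈⟨ S.*-congˡ Φ≈1+Ψ ⟩
  θ S.* (S.1# S.+ Ψ)       ∎
  where open import Relation.Binary.Reasoning.Setoid S.setoid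

NΨ^ : ∀ d → N (Ψ ^ˢ suc d) S.≈ suc d ×ˢ (θ S.* (Ψ ^ˢ d S.+ Ψ ^ˢ suc d))
NΨ^ = LogarithmicDerivative.N-^ (PowerSeries.ring endoRing) N N-⋆ (N-const E.1#) θΨ≈Ψθ NΨ≈θ[1+Ψ]

×ˢ-coefficient : ∀ k F n → (k ×ˢ F) n E.≈ k ×ᴱ F n
×ˢ-coefficient zero    F n = E.refl
×ˢ-coefficient (suc k) F n = E.+-congˡ {F n} (×ˢ-coefficient k F n)

-- Arithmetic of fractions.

fromℚᵘ-* : ∀ r s → ℚ.fromℚᵘ r ℚ.* ℚ.fromℚᵘ s ≡ ℚ.fromℚᵘ (r ℚᵘ.* s)
fromℚᵘ-* r s = ℚ.toℚᵘ-injective (ℚᵘ.≃-trans (ℚ.toℚᵘ-homo-* (ℚ.fromℚᵘ r) (ℚ.fromℚᵘ s))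
  (ℚᵘ.≃-trans (ℚᵘ.*-cong (ℚ.toℚᵘ-fromℚᵘ r) (ℚ.toℚᵘ-fromℚᵘ s)) (ℚᵘ.≃-sym (ℚ.toℚᵘ-fromℚᵘ (r ℚᵘ.* s)))))

fromℚᵘ-+ : ∀ r s → ℚ.fromℚᵘ r ℚ.+ ℚ.fromℚᵘ s ≡ ℚ.fromℚᵘ (r ℚᵘ.+ s)
fromℚᵘ-+ r s = ℚ.toℚᵘ-injective (ℚᵘ.≃-trans (ℚ.toℚᵘ-homo-+ (ℚ.fromℚᵘ r) (ℚ.fromℚᵘ s))
  (ℚᵘ.≃-trans (ℚᵘ.+-cong (ℚ.toℚᵘ-fromℚᵘ r) (ℚ.toℚᵘ-fromℚᵘ s)) (ℚᵘ.≃-sym (ℚ.toℚᵘ-fromℚᵘ (r ℚᵘ.+ s)))))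

-- The quotient `i / d` is normalised by a gcd that does not compute on variables. Over unnormalised
-- fractions the claim is a cross multiplication of integers.
/-*-cancel : ∀ i d .{{_ : NonZero d}} → (i / d) ℚ.* (+ d / 1) ≡ i / 1
/-*-cancel i (suc d) = trans (fromℚᵘ-* (mkℚᵘ i d) (mkℚᵘ (+ suc d) 0)) (ℚ.fromℚᵘ-cong
  {mkℚᵘ i d ℚᵘ.* mkℚᵘ (+ suc d) 0} {mkℚᵘ i 0}
  (*≡* (trans (ℤ.*-identityʳ (i ℤ.* + suc d)) (cong (λ k → i ℤ.* + suc k) (sym (ℕ.*-identityʳ d))))))

suc/1 : ∀ k → + suc k / 1 ≡ 1ℚ ℚ.+ (+ k / 1)
suc/1 k = sym (trans (fromℚᵘ-+ (mkℚᵘ (+ 1) 0) (mkℚᵘ (+ k) 0)) (ℚ.fromℚᵘ-cong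
  {mkℚᵘ (+ 1) 0 ℚᵘ.+ mkℚᵘ (+ k) 0} {mkℚᵘ (+ suc k) 0}
  (*≡* (cong (λ j → (+ 1 ℤ.+ j) ℤ.* + 1) (ℤ.*-identityʳ (+ k))))))

-1*/1 : ∀ i → (-1ℤ ℤ.* i) / 1 ≡ ℚ.- (i / 1)
-1*/1 i = trans (sym (fromℚᵘ-* (mkℚᵘ -1ℤ 0) (mkℚᵘ i 0)))
  (trans (sym (ℚ.neg-distribˡ-* 1ℚ (i / 1))) (cong ℚ.-_ (ℚ.*-identityˡ (i / 1))))

eval-× : ∀ k F w φ → eval ((k ×ᴱ F) w) φ ≡ (+ k / 1) ℚ.* eval (F w) φ
eval-× zero    F w φ = trans (eval-[] φ) (sym (ℚ.*-zeroˡ (eval (F w) φ)))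
eval-× (suc k) F w φ = begin
  eval (F w +ᴹ (k ×ᴱ F) w) φ                              ≡⟨ eval-++ (F w) ((k ×ᴱ F) w) φ ⟩
  eval (F w) φ ℚ.+ eval ((k ×ᴱ F) w) φ                    ≡⟨ cong₂ ℚ._+_ (sym (ℚ.*-identityˡ (eval (F w) φ))) (eval-× k F w φ) ⟩
  1ℚ ℚ.* eval (F w) φ ℚ.+ (+ k / 1) ℚ.* eval (F w) φ      ≡⟨ ℚ.*-distribʳ-+ (eval (F w) φ) 1ℚ (+ k / 1) ⟨
  (1ℚ ℚ.+ (+ k / 1)) ℚ.* eval (F w) φ                     ≡⟨ cong (ℚ._* eval (F w) φ) (suc/1 k) ⟨
  (+ suc k / 1) ℚ.* eval (F w) φ                          ∎
  where open ≡-Reasoning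

-- Sums over compositions

∑-++ : ∀ {A B : Set} (p : A → Free B) as bs φ → eval (∑ (as ++ bs) p) φ ≡ eval (∑ as p) φ ℚ.+ eval (∑ bs p) φ
∑-++ p as bs φ = trans (cong (λ q → eval q φ) (List.concatMap-++ p as bs)) (eval-++ (∑ as p) (∑ bs p) φ)

∑-cong : ∀ {A B C : Set} {p : A → Free B} {q : A → Free C} as {φ ψ} →
  (∀ a → eval (p a) φ ≡ eval (q a) ψ) → eval (∑ as p) φ ≡ eval (∑ as q) ψ
∑-cong                 []       {φ} {ψ} e = trans (eval-[] φ) (sym (eval-[] ψ))
∑-cong {p = p} {q = q} (a ∷ as) {φ} {ψ} e = trans (eval-++ (p a) (∑ as p) φ)
  (trans (cong₂ ℚ._+_ (e a) (∑-cong as e)) (sym (eval-++ (q a) (∑ as q) ψ)))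

∑-concatMap : ∀ {A B C : Set} (p : B → Free C) (f : A → List B) as φ →
  eval (∑ (concatMap f as) p) φ ≡ eval (∑ as (λ a → ∑ (f a) p)) φ
∑-concatMap p f []       φ = refl
∑-concatMap p f (a ∷ as) φ = trans (∑-++ p (f a) (concatMap f as) φ)
  (trans (cong (eval (∑ (f a) p) φ ℚ.+_) (∑-concatMap p f as φ))
    (sym (eval-++ (∑ (f a) p) (∑ as (λ a → ∑ (f a) p)) φ)))

∑-applyUpTo : ∀ {A B : Set} (f : ℕ → A) (p : A → Free B) φ K n →
  (∀ i j → i ℕ.+ j ≡ n → eval (p (f i)) φ ≡ K i j) →
  eval (∑ (applyUpTo f (suc n)) p) φ ≡ conv K n
∑-applyUpTo f p φ K zero    e = trans (eval-++ (p (f 0)) [] φ)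
  (trans (cong (eval (p (f 0)) φ ℚ.+_) (eval-[] φ)) (trans (ℚ.+-identityʳ _) (e 0 0 refl)))
∑-applyUpTo f p φ K (suc n) e = trans (eval-++ (p (f 0)) _ φ)
  (cong₂ ℚ._+_ (e 0 (suc n) refl)
    (∑-applyUpTo (λ i → f (suc i)) p φ _ n (λ i j i+j≡n → e (suc i) j (cong suc i+j≡n))))

-- Splitting off the first part m corresponds to Ψᵈ⁺¹ = Ψ Ψᵈ, with `wordMap-ladder-++` turning the
-- forest into a composite. The induction hypothesis is used at the functional φ composed with Φₘ,
-- hence the generality in φ.
∑-compositions : ∀ d n w φ →
  eval (∑ (compositions d n) (λ ms → wordMap (ladders ms) w)) φ ≡ eval ((Ψ ^ˢ d) n w) φ
∑-compositions zero    zero    w φ = trans (cong (λ p → eval p φ) (List.++-identityʳ (wordMap [] w)))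
  (trans (eval-Φ-zero w φ) (sym (eval-η w φ)))
∑-compositions zero    (suc n) w φ = refl
∑-compositions (suc d) n       w φ = trans
  (∑-concatMap (λ ms → wordMap (ladders ms) w) _ (applyUpTo suc n) φ)
  (trans (sum n) (sym (eval-⋆ Ψ (Ψ ^ˢ d) n w φ)))
  where
  K : ℕ → ℕ → ℚ
  K i j = eval ((Ψ ^ˢ d) j w) (λ v → eval (Ψ i v) φ)

  -- The parts of a composition start at 1 but the convolution starts at 0; the extra term vanishes
  -- because Ψ has no constant coefficient.
  K-zero : ∀ j → K 0 j ≡ 0ℚ
  K-zero j = trans (eval-cong ((Ψ ^ˢ d) j w) (λ v → eval-[] φ)) (eval-0 ((Ψ ^ˢ d) j w))

  starting-with : ℕ → ℕ → 𝔥
  starting-with n m = ∑ (map (m ∷_) (compositions d (n ∸ m))) (λ ms → wordMap (ladders ms) w)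

  term : ∀ n i j → i ℕ.+ j ≡ n → eval (starting-with (suc n) (suc i)) φ ≡ K (suc i) j
  term n i j refl = begin
    eval (∑ (map (suc i ∷_) (compositions d (n ∸ i))) (λ ms → wordMap (ladders ms) w)) φ
      ≡⟨ cong (λ p → eval p φ)
             (List.concatMap-map (λ ms → wordMap (ladders ms) w) (suc i ∷_) (compositions d (n ∸ i))) ⟩
    eval (∑ (compositions d (n ∸ i)) (λ ms → wordMap (ladder (suc i) ++ ladders ms) w)) φ
      ≡⟨ ∑-cong (compositions d (n ∸ i)) (λ ms → wordMap-ladder-++ w (suc i) (ladders ms) φ) ⟩
    eval (∑ (compositions d (n ∸ i)) (λ ms → wordMap (ladders ms) w)) (λ v → eval (Φ (suc i) v) φ)
      ≡⟨ ∑-compositions d (n ∸ i) w _ ⟩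
    K (suc i) (n ∸ i)
      ≡⟨ cong (K (suc i)) (ℕ.m+n∸m≡n i j) ⟩
    K (suc i) j ∎
    where open ≡-Reasoning

  sum : ∀ n → eval (∑ (applyUpTo suc n) (starting-with n)) φ ≡ conv K n
  sum zero    = trans (eval-[] φ) (sym (K-zero 0))
  sum (suc n) = trans (∑-applyUpTo suc (starting-with (suc n)) φ (λ i → K (suc i)) n (term n))
    (trans (sym (ℚ.+-identityˡ _)) (cong (ℚ._+ conv (λ i → K (suc i)) n) (sym (K-zero (suc n)))))

eval-∑-lin : ∀ {A B C : Set} (f : A → B → Free C) as (p : Free B) φ →
  eval (∑ as (λ a → lin (f a) p)) φ ≡ eval p (λ b → eval (∑ as (λ a → f a b)) φ)
eval-∑-lin f []       p φ = trans (eval-[] φ) (sym (trans (eval-cong p (λ _ → eval-[] φ)) (eval-0 p)))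
eval-∑-lin f (a ∷ as) p φ = trans (eval-++ (lin (f a) p) (∑ as (λ a → lin (f a) p)) φ)
  (trans (cong₂ ℚ._+_ (eval-lin (f a) p φ) (eval-∑-lin f as p φ))
    (sym (trans (eval-cong p (λ b → eval-++ (f a b) (∑ as (λ a → f a b)) φ)) (eval-+ p _ _))))

-- Divisibility by powers of t, and the telescoping sum.

Vanishes< : ℕ → (ℕ → Endo) → Set
Vanishes< d F = ∀ n → n < d → ∀ w φ → eval (F n w) φ ≡ 0ℚ

-- If t divides F and tᵈ divides G, then tᵈ⁺¹ divides the product. This is why the logarithm stops
-- at d = n in degree n.
⋆-vanishes : ∀ {d F G} → (∀ w φ → eval (F 0 w) φ ≡ 0ℚ) → Vanishes< d G → Vanishes< (suc d) (F S.* G)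
⋆-vanishes {d} {F} {G} F0 Gd n (s≤s n≤d) w φ = trans (eval-⋆ F G n w φ)
  (trans (conv-cong-+ n zeros) (conv-ε n))
  where
  zeros : ∀ i j → i ℕ.+ j ≡ n → eval (G j w) (λ v → eval (F i v) φ) ≡ 0ℚ
  zeros zero    j e = trans (eval-cong (G j w) (λ v → F0 v φ)) (eval-0 (G j w))
  zeros (suc i) j e = Gd j (ℕ.≤-trans (ℕ.≤-trans (s≤s (ℕ.m≤n+m j i)) (ℕ.≤-reflexive e)) n≤d) w _

Ψ^-vanishes : ∀ d → Vanishes< d (Ψ ^ˢ d)
Ψ^-vanishes zero    n ()
Ψ^-vanishes (suc d) = ⋆-vanishes (λ w φ → eval-[] φ) (Ψ^-vanishes d)

module Telescope (n : ℕ) .{{_ : NonZero n}} (p : 𝔥) (φ : Word → ℚ) where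
  open ≡-Reasoning

  -- This is (-1)ᵏ, with the exponent left as it occurs in the summand d = k + 1.
  sign : ℕ → ℚ
  sign k = (-1ℤ ℤ.^ suc (suc k)) / 1

  -- `T` is the telescoping quantity: n C(d+1) / (d+1) = T(d) + T(d+1), so the alternating sum
  -- leaves only T(0), which is the multiple of ∂ₙ, and T(n).
  C T : ℕ → ℚ
  C d = eval (lin ((Ψ ^ˢ d) n) p) φ
  T d = eval (lin ((θ S.* Ψ ^ˢ d) n) p) φ

  eval-lin-E : ∀ {F F′} → F E.≈ F′ → eval (lin F p) φ ≡ eval (lin F′ p) φ
  eval-lin-E {F} {F′} e = trans (eval-lin F p φ)
    (trans (eval-cong p (λ w → on e w φ)) (sym (eval-lin F′ p φ)))

  eval-lin-× : ∀ k F → eval (lin (k ×ᴱ F) p) φ ≡ (+ k / 1) ℚ.* eval (lin F p) φ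
  eval-lin-× k F = trans (eval-lin (k ×ᴱ F) p φ) (trans (eval-cong p (λ w → eval-× k F w φ))
    (trans (eval-* p (+ k / 1) _) (cong ((+ k / 1) ℚ.*_) (sym (eval-lin F p φ)))))

  nC : ∀ d → (+ n / 1) ℚ.* C (suc d) ≡ (+ suc d / 1) ℚ.* (T d ℚ.+ T (suc d))
  nC d = begin
    (+ n / 1) ℚ.* C (suc d)
      ≡⟨ eval-lin-× n ((Ψ ^ˢ suc d) n) ⟨
    eval (lin (n ×ᴱ (Ψ ^ˢ suc d) n) p) φ
      ≡⟨ eval-lin-E (E.trans (at (NΨ^ d) n) (×ˢ-coefficient (suc d) (θ S.* (Ψ ^ˢ d S.+ Ψ ^ˢ suc d)) n)) ⟩
    eval (lin (suc d ×ᴱ (θ S.* (Ψ ^ˢ d S.+ Ψ ^ˢ suc d)) n) p) φ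
      ≡⟨ eval-lin-× (suc d) ((θ S.* (Ψ ^ˢ d S.+ Ψ ^ˢ suc d)) n) ⟩
    (+ suc d / 1) ℚ.* eval (lin ((θ S.* (Ψ ^ˢ d S.+ Ψ ^ˢ suc d)) n) p) φ
      ≡⟨ cong ((+ suc d / 1) ℚ.*_) (trans (eval-lin-E (at (S.distribˡ θ (Ψ ^ˢ d) (Ψ ^ˢ suc d)) n)) split) ⟩
    (+ suc d / 1) ℚ.* (T d ℚ.+ T (suc d)) ∎
    where
    split : eval (lin ((θ S.* Ψ ^ˢ d S.+ θ S.* Ψ ^ˢ suc d) n) p) φ ≡ T d ℚ.+ T (suc d)
    split = trans (eval-lin _ p φ) (trans (eval-cong p (λ w → eval-++ ((θ S.* Ψ ^ˢ d) n w) _ φ))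
      (trans (eval-+ p _ _) (cong₂ ℚ._+_ (sym (eval-lin ((θ S.* Ψ ^ˢ d) n) p φ))
        (sym (eval-lin ((θ S.* Ψ ^ˢ suc d) n) p φ)))))

  T-zero : T 0 ≡ (+ (2^ n ∸1) / 1) ℚ.* eval (∂ n p) φ
  T-zero = trans (eval-lin-E (at (S.*-identityʳ θ) n)) (eval-lin-× (2^ n ∸1) (∂-word n))

  -- θ has no constant coefficient because 2⁰ - 1 = 0, so θ Ψⁿ starts only in degree n + 1.
  T-last : T n ≡ 0ℚ
  T-last = trans (eval-lin ((θ S.* Ψ ^ˢ n) n) p φ) (trans
    (eval-cong p (λ w → ⋆-vanishes (λ w φ → eval-[] φ) (Ψ^-vanishes n) n (ℕ.n<1+n n) w φ)) (eval-0 p))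

  summand : ∀ d → .{{NonZero d}} → 𝔥
  summand d = ((-1ℤ ℤ.^ suc d) / d) *ₗ ∑ (compositions d n) (λ ms → ⟦ ladders ms ⟧ p)

  n-summand : ∀ k → (+ n / 1) ℚ.* eval (summand (suc k)) φ ≡ sign k ℚ.* (T k ℚ.+ T (suc k))
  n-summand k = begin
    (+ n / 1) ℚ.* eval (summand (suc k)) φ
      ≡⟨ cong ((+ n / 1) ℚ.*_) (trans (eval-*ₗ c _ φ) (cong (c ℚ.*_) compositions-sum)) ⟩
    (+ n / 1) ℚ.* (c ℚ.* C (suc k))
      ≡⟨ x*yz≡y*xz (+ n / 1) c (C (suc k)) ⟩
    c ℚ.* ((+ n / 1) ℚ.* C (suc k))
      ≡⟨ cong (c ℚ.*_) (nC k) ⟩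
    c ℚ.* ((+ suc k / 1) ℚ.* (T k ℚ.+ T (suc k)))
      ≡⟨ ℚ.*-assoc c (+ suc k / 1) _ ⟨
    c ℚ.* (+ suc k / 1) ℚ.* (T k ℚ.+ T (suc k))
      ≡⟨ cong (ℚ._* (T k ℚ.+ T (suc k))) (/-*-cancel (-1ℤ ℤ.^ suc (suc k)) (suc k)) ⟩
    sign k ℚ.* (T k ℚ.+ T (suc k)) ∎
    where
    c : ℚ
    c = (-1ℤ ℤ.^ suc (suc k)) / suc k

    compositions-sum : eval (∑ (compositions (suc k) n) (λ ms → ⟦ ladders ms ⟧ p)) φ ≡ C (suc k)
    compositions-sum = trans (eval-∑-lin (λ ms → wordMap (ladders ms)) (compositions (suc k) n) p φ)
      (trans (eval-cong p (λ w → ∑-compositions (suc k) n w φ)) (sym (eval-lin ((Ψ ^ˢ suc k) n) p φ)))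

  sign-suc : ∀ k → sign (suc k) ≡ ℚ.- sign k
  sign-suc k = -1*/1 (-1ℤ ℤ.^ suc (suc k))

  telescope : ∀ m → (+ n / 1) ℚ.* eval (∑₁ m summand) φ ≡ T 0 ℚ.- sign m ℚ.* T m
  telescope zero    = begin
    (+ n / 1) ℚ.* eval 0ᴹ φ     ≡⟨ cong ((+ n / 1) ℚ.*_) (eval-[] φ) ⟩
    (+ n / 1) ℚ.* 0ℚ            ≡⟨ ℚ.*-zeroʳ (+ n / 1) ⟩
    0ℚ                          ≡⟨ ℚ.+-inverseʳ (T 0) ⟨
    T 0 ℚ.- T 0                 ≡⟨ cong (λ u → T 0 ℚ.- u) (ℚ.*-identityˡ (T 0)) ⟨
    T 0 ℚ.- sign 0 ℚ.* T 0      ∎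
  telescope (suc m) = begin
    (+ n / 1) ℚ.* eval (∑₁ (suc m) summand) φ
      ≡⟨ cong (λ ks → (+ n / 1) ℚ.* eval (∑ ks (λ k → summand (suc k))) φ) (List.upTo-∷ʳ m) ⟨
    (+ n / 1) ℚ.* eval (∑ (upTo m ∷ʳ m) (λ k → summand (suc k))) φ
      ≡⟨ cong ((+ n / 1) ℚ.*_) (trans (∑-++ (λ k → summand (suc k)) (upTo m) [ m ] φ)
           (cong (λ q → eval (∑₁ m summand) φ ℚ.+ eval q φ) (List.++-identityʳ (summand (suc m))))) ⟩
    (+ n / 1) ℚ.* (eval (∑₁ m summand) φ ℚ.+ eval (summand (suc m)) φ)
      ≡⟨ ℚ.*-distribˡ-+ (+ n / 1) _ _ ⟩
    (+ n / 1) ℚ.* eval (∑₁ m summand) φ ℚ.+ (+ n / 1) ℚ.* eval (summand (suc m)) φ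
      ≡⟨ cong₂ ℚ._+_ (telescope m) (trans (n-summand m) (ℚ.*-distribˡ-+ (sign m) (T m) (T (suc m)))) ⟩
    T 0 ℚ.- sTm ℚ.+ (sTm ℚ.+ sign m ℚ.* T (suc m))
      ≡⟨ cancel (T 0) sTm _ ⟩
    T 0 ℚ.+ sign m ℚ.* T (suc m)
      ≡⟨ cong (T 0 ℚ.+_) (trans (ℚ.neg-distribˡ-* (ℚ.- sign m) (T (suc m)))
           (cong (ℚ._* T (suc m)) (neg-involutive (sign m)))) ⟨
    T 0 ℚ.- (ℚ.- sign m) ℚ.* T (suc m)
      ≡⟨ cong (λ s → T 0 ℚ.- s ℚ.* T (suc m)) (sign-suc m) ⟨
    T 0 ℚ.- sign (suc m) ℚ.* T (suc m) ∎
    where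
    sTm : ℚ
    sTm = sign m ℚ.* T m

    cancel : ∀ a b c → a ℚ.- b ℚ.+ (b ℚ.+ c) ≡ a ℚ.+ c
    cancel a b c = begin
      a ℚ.- b ℚ.+ (b ℚ.+ c)        ≡⟨ ℚ.+-assoc a (ℚ.- b) (b ℚ.+ c) ⟩
      a ℚ.+ (ℚ.- b ℚ.+ (b ℚ.+ c))  ≡⟨ cong (a ℚ.+_) (ℚ.+-assoc (ℚ.- b) b c) ⟨
      a ℚ.+ (ℚ.- b ℚ.+ b ℚ.+ c)    ≡⟨ cong (λ d → a ℚ.+ (d ℚ.+ c)) (ℚ.+-inverseˡ b) ⟩
      a ℚ.+ (0ℚ ℚ.+ c)             ≡⟨ cong (a ℚ.+_) (ℚ.+-identityˡ c) ⟩
      a ℚ.+ c                      ∎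

  n-sum : (+ n / 1) ℚ.* eval (∑₁ n summand) φ ≡ (+ (2^ n ∸1) / 1) ℚ.* eval (∂ n p) φ
  n-sum = begin
    (+ n / 1) ℚ.* eval (∑₁ n summand) φ    ≡⟨ telescope n ⟩
    T 0 ℚ.- sign n ℚ.* T n                 ≡⟨ cong (λ u → T 0 ℚ.- sign n ℚ.* u) T-last ⟩
    T 0 ℚ.- sign n ℚ.* 0ℚ                  ≡⟨ cong (λ u → T 0 ℚ.- u) (ℚ.*-zeroʳ (sign n)) ⟩
    T 0 ℚ.+ 0ℚ                             ≡⟨ ℚ.+-identityʳ (T 0) ⟩
    T 0                                    ≡⟨ T-zero ⟩
    (+ (2^ n ∸1) / 1) ℚ.* eval (∂ n p) φ   ∎

-- The telescoping is carried out after multiplication by n, which leaves one division, by N = 2ⁿ -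
-- 1, for the end.
divide : ∀ n N .{{_ : NonZero N}} {s d} → (+ n / 1) ℚ.* s ≡ (+ N / 1) ℚ.* d → d ≡ (+ n / N) ℚ.* s
divide n N {s} {d} e = begin
  d                                             ≡⟨ cancelled d ⟨
  (+ 1 / N) ℚ.* ((+ N / 1) ℚ.* d)               ≡⟨ cong ((+ 1 / N) ℚ.*_) e ⟨
  (+ 1 / N) ℚ.* ((+ n / 1) ℚ.* s)               ≡⟨ cong (λ m → (+ 1 / N) ℚ.* (m ℚ.* s)) (/-*-cancel (+ n) N) ⟨
  (+ 1 / N) ℚ.* ((+ n / N) ℚ.* (+ N / 1) ℚ.* s) ≡⟨ cong (λ u → (+ 1 / N) ℚ.* (u ℚ.* s)) (ℚ.*-comm (+ n / N) (+ N / 1)) ⟩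
  (+ 1 / N) ℚ.* ((+ N / 1) ℚ.* (+ n / N) ℚ.* s) ≡⟨ cong ((+ 1 / N) ℚ.*_) (ℚ.*-assoc (+ N / 1) (+ n / N) s) ⟩
  (+ 1 / N) ℚ.* ((+ N / 1) ℚ.* ((+ n / N) ℚ.* s)) ≡⟨ cancelled ((+ n / N) ℚ.* s) ⟩
  (+ n / N) ℚ.* s                               ∎
  where
  open ≡-Reasoning
  cancelled : ∀ u → (+ 1 / N) ℚ.* ((+ N / 1) ℚ.* u) ≡ u
  cancelled u = trans (sym (ℚ.*-assoc (+ 1 / N) (+ N / 1) u))
    (trans (cong (ℚ._* u) (/-*-cancel (+ 1) N)) (ℚ.*-identityˡ u))

theorem1p4 : ∀ (n : ℕ) .{{_ : NonZero n}} (p : 𝔥) →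
    ∂ n p
    ≈ (_/_ (+ n) (2 ℕ.^ n ∸ 1) {{2^n∸1-nonZero n}}) *ₗ
    ∑₁ n (λ d → ((-1ℤ ℤ.^ suc d) / d) *ₗ
    ∑ (compositions d n) (λ ms → ⟦ ladders ms ⟧ p))
theorem1p4 n p w = begin
  coeff (∂ n p) w                                      ≡⟨ coeff≡eval (∂ n p) w ⟩
  eval (∂ n p) _                                       ≡⟨ divide n (2 ℕ.^ n ∸ 1) {{2^n∸1-nonZero n}} n-sum ⟩
  n/[2^n∸1] ℚ.* eval (∑₁ n summand) _                  ≡⟨ eval-*ₗ n/[2^n∸1] (∑₁ n summand) _ ⟨
  eval (n/[2^n∸1] *ₗ ∑₁ n summand) _                   ≡⟨ coeff≡eval (n/[2^n∸1] *ₗ ∑₁ n summand) w ⟨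
  coeff (n/[2^n∸1] *ₗ ∑₁ n summand) w                  ∎
  where
  open ≡-Reasoning
  open Telescope n p (λ v → if does (v ≟ᵂ w) then 1ℚ else 0ℚ) using (summand; n-sum)
  n/[2^n∸1] : ℚ
  n/[2^n∸1] = _/_ (+ n) (2 ℕ.^ n ∸ 1) {{2^n∸1-nonZero n}}
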